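{- Let $\theta,\eta$ be irrational real numbers, let $\varpi_\upsilon=\varpi_\upsilon(\theta,\eta)>1$, and let $\mathfrak{g}_{\varpi_\upsilon}$ be the largest root of the polynomial $$G_{\varpi_\upsilon}(x)=x^2-(\varpi_\upsilon^2-2\varpi_\upsilon+3)\,x+1.$$ Then $$\max(\omega(\theta),\omega(\eta))\ \ge\ \mathfrak{g}_{\varpi_\upsilon}\ >\ \varpi_\upsilon.$$
   Context: $\|x\|$ denotes the distance from the real number $x$ to the nearest integer, and $\mathbb{Z}_+$ is the set of positive integers. For an irrational real number $\theta$ and real $t\ge1$ define $$\psi_\theta(t)=\min_{q\in\mathbb{Z}_+:\,q\le t}\|q\theta\|,\qquad \upsilon_\theta(t)=\min_{q\in\mathbb{Z}_+:\,q\le t} q\cdot\|q\theta\|,$$ and the ordinary Diophantine exponent $$\omega(\theta)=\sup\{\gamma\in\mathbb{R}:\ \liminf_{t\to\infty}t^{\gamma}\psi_\theta(t)<\infty\}.$$ For two irrational real numbers $\theta,\eta$ define $\upsilon_{\theta,\eta}(t)=\min(\upsilon_\theta(t),\upsilon_\eta(t))$ and $$\varpi_\upsilon(\theta,\eta)=\sup\{\gamma\in\mathbb{R}:\ \limsup_{t\to\infty}t^{\gamma-1}\upsilon_{\theta,\eta}(t)<\infty\}.$$ -}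

module Defs where

open import Algebra.Bundles using (CommutativeRing; Semiring)
open import Axiom.ExcludedMiddle using (ExcludedMiddle)
open import Data.Integer.Base as ℤ using (ℤ; +_; -[1+_])
open import Data.Nat.Base as ℕ using (ℕ; suc)
open import Data.Product using (∃; _×_; _,_; proj₁)
open import Data.Rational.Base as ℚ using (ℚ; ↥_; ↧_; ↧ₙ_)
open import Level using (0ℓ)
open import Relation.Binary.Bundles using (TotalOrder)
open import Relation.Binary.Core using (Rel)
open import Relation.Binary.Structures using (IsTotalOrder)
open import Relation.Nullary using (¬_; yes; no)
open import Relation.Nullary.Construct.Add.Extrema using (_±; ⊥±; ⊤±; [_])
open import Relation.Unary using (Pred)
import Algebra.Construct.NaturalChoice.Max as Max
import Algebra.Construct.NaturalChoice.Min as Min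
import Algebra.Definitions.RawSemiring as RawSemiringDefs
import Relation.Binary.Construct.Add.Extrema.Equality as EqualityExtrema
import Relation.Binary.Construct.Add.Extrema.NonStrict as NonStrictExtrema
import Relation.Binary.Construct.Add.Extrema.Strict as StrictExtrema
import Relation.Binary.Construct.NonStrictToStrict as ToStrict

module Bounds {A : Set} (_≤_ : Rel A 0ℓ) where

  IsUpperBound : {I : Set} → (I → A) → Pred A 0ℓ
  IsUpperBound f u = ∀ i → f i ≤ u

  IsLowerBound : {I : Set} → (I → A) → Pred A 0ℓ
  IsLowerBound f l = ∀ i → l ≤ f i

  IsSupremum : {I : Set} → (I → A) → Pred A 0ℓ
  IsSupremum f s = IsUpperBound f s × (∀ u → IsUpperBound f u → s ≤ u)

  IsInfimum : {I : Set} → (I → A) → Pred A 0ℓ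
  IsInfimum f s = IsLowerBound f s × (∀ l → IsLowerBound f l → l ≤ s)

-- Dedekind-complete ordered fields: the axioms that characterise the field of
-- real numbers up to unique isomorphism (given excluded middle).
record CompleteOrderedField : Set₁ where
  field
    commutativeRing : CommutativeRing 0ℓ 0ℓ
  open CommutativeRing commutativeRing public
  infix 4 _≤_
  field
    _≤_          : Rel Carrier 0ℓ
    isTotalOrder : IsTotalOrder _≈_ _≤_
    0≉1          : ¬ (0# ≈ 1#)
    inverse      : ∀ x → ¬ (x ≈ 0#) → ∃ λ y → x * y ≈ 1#
    +-monoʳ-≤    : ∀ x y z → y ≤ z → x + y ≤ x + z
    *-nonNeg     : ∀ x y → 0# ≤ x → 0# ≤ y → 0# ≤ x * y
    complete     : ∀ {I : Set} (f : I → Carrier) → I →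
                   ∃ (Bounds.IsUpperBound _≤_ f) → ∃ (Bounds.IsSupremum _≤_ f)

  totalOrder : TotalOrder 0ℓ 0ℓ 0ℓ
  totalOrder = record { isTotalOrder = isTotalOrder }

  open ToStrict _≈_ _≤_ public using (_<_)

module Exponents (lem : ExcludedMiddle 0ℓ) (R : CompleteOrderedField) where

  open CompleteOrderedField R public renaming (Carrier to ℝ)
  open RawSemiringDefs (Semiring.rawSemiring semiring) public using (_^_) renaming (_×_ to _·_)
  open Max totalOrder public using () renaming (_⊔_ to _⊔ᴿ_)
  open Min totalOrder public using () renaming (_⊓_ to _⊓ᴿ_)
  open EqualityExtrema _≈_ public using (_≈±_)
  open NonStrictExtrema _≤_ public using (_≤±_)
  open StrictExtrema _<_ public using (_<±_)

  ℝ±-totalOrder : TotalOrder 0ℓ 0ℓ 0ℓ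
  ℝ±-totalOrder = record
    { isTotalOrder = NonStrictExtrema.≤±-isTotalOrder _≤_ isTotalOrder }

  open Max ℝ±-totalOrder public using () renaming (_⊔_ to _⊔±_)

  -- An element satisfying P, or the default d if there is none.  It is used
  -- below only for predicates that determine an element up to equality.
  the : {A : Set} → A → Pred A 0ℓ → A
  the d P with lem {P = ∃ P}
  ... | yes (x , _) = x
  ... | no  _       = d

  minimum : {I : Set} → (I → ℝ) → ℝ
  minimum f = the 0# λ x → (∃ λ i → x ≈ f i) × Bounds.IsLowerBound _≤_ f x

  maximum : {I : Set} → (I → ℝ) → ℝ
  maximum f = the 0# λ x → (∃ λ i → x ≈ f i) × Bounds.IsUpperBound _≤_ f x

  supremum : {I : Set} → (I → ℝ) → ℝ
  supremum f = the 0# (Bounds.IsSupremum _≤_ f)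

  -- In the extended reals these always exist, by completeness of ℝ.
  ⨆ : {I : Set} → (I → ℝ ±) → ℝ ±
  ⨆ f = the ⊥± (Bounds.IsSupremum _≤±_ f)

  ⨅ : {I : Set} → (I → ℝ ±) → ℝ ±
  ⨅ f = the ⊤± (Bounds.IsInfimum _≤±_ f)

  -- As t → ∞, for functions considered on [1,∞) only.
  limsup : (ℝ → ℝ) → ℝ ±
  limsup f = ⨅ {I = ∃ λ T → 1# ≤ T} λ (T , _) →
             ⨆ {I = ∃ λ t → T ≤ t}  λ (t , _) → [ f t ]

  liminf : (ℝ → ℝ) → ℝ ±
  liminf f = ⨆ {I = ∃ λ T → 1# ≤ T} λ (T , _) →
             ⨅ {I = ∃ λ t → T ≤ t}  λ (t , _) → [ f t ]

  fromℕ : ℕ → ℝ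
  fromℕ n = n · 1#

  fromℤ : ℤ → ℝ
  fromℤ (+ n)    = fromℕ n
  fromℤ -[1+ n ] = - fromℕ (suc n)

  Irrational : Pred ℝ 0ℓ
  Irrational θ = ¬ (∃ λ (r : ℚ) → fromℤ (↧ r) * θ ≈ fromℤ (↥ r))

  -- s = t ^ (p / q) for t > 0, that is, s ≥ 0 and s ^ q = t ^ p.
  IsRationalPower : ℝ → ℚ → ℝ → Set
  IsRationalPower t r s = 0# ≤ s × powerEq (↥ r)
    where
    powerEq : ℤ → Set
    powerEq (+ n)    = s ^ (↧ₙ r) ≈ t ^ n
    powerEq -[1+ n ] = s ^ (↧ₙ r) * t ^ suc n ≈ 1#

  _≤ℚ_ : ℚ → ℝ → Set
  r ≤ℚ γ = fromℤ (↥ r) ≤ fromℤ (↧ r) * γ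

  -- Real powers of t ≥ 1: the supremum of all t ^ r with r rational, r ≤ γ.
  -- The value is not meaningful for t < 1.
  infixr 8 _^ᴿ_
  _^ᴿ_ : ℝ → ℝ → ℝ
  t ^ᴿ γ = supremum
    {I = ∃ λ s → ∃ λ r → r ≤ℚ γ × IsRationalPower t r s} proj₁

  ∣_∣ : ℝ → ℝ
  ∣ x ∣ = x ⊔ᴿ (- x)

  ‖_‖ : ℝ → ℝ
  ‖ x ‖ = minimum λ (n : ℤ) → ∣ x - fromℤ n ∣

  ℤ₊≤ : ℝ → Set
  ℤ₊≤ t = ∃ λ (q : ℕ) → 1 ℕ.≤ q × fromℕ q ≤ t

  ψ : ℝ → ℝ → ℝ
  ψ θ t = minimum {I = ℤ₊≤ t} λ (q , _) → ‖ fromℕ q * θ ‖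

  υ : ℝ → ℝ → ℝ
  υ θ t = minimum {I = ℤ₊≤ t} λ (q , _) → fromℕ q * ‖ fromℕ q * θ ‖

  υ₂ : ℝ → ℝ → ℝ → ℝ
  υ₂ θ η t = υ θ t ⊓ᴿ υ η t

  ω : ℝ → ℝ ±
  ω θ = ⨆ {I = ∃ λ γ → liminf (λ t → t ^ᴿ γ * ψ θ t) <± ⊤±} λ (γ , _) → [ γ ]

  ϖ-υ : ℝ → ℝ → ℝ ±
  ϖ-υ θ η =
    ⨆ {I = ∃ λ γ → limsup (λ t → t ^ᴿ (γ - 1#) * υ₂ θ η t) <± ⊤±}
      λ (γ , _) → [ γ ]

  G : ℝ → ℝ → ℝ
  G ϖ x = x ^ 2 - (ϖ ^ 2 - fromℕ 2 * ϖ + fromℕ 3) * x + 1#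

  𝔤 : ℝ → ℝ
  𝔤 ϖ = maximum {I = ∃ λ x → G ϖ x ≈ 0#} proj₁

{-# OPTIONS --safe #-}
module Submission where

-- Call q ‖qα‖, for α one of θ and η, the quality of q at α.  Let Q₀ < Q₁ < Q₂ be
-- three consecutive records of small quality, with values v₀ > v₁ > v₂.  Two of
-- them belong to the same number α, and distinct fractions with denominators q
-- and q′ satisfy 1 ≤ q ∣q′α − p′∣ + q′ ∣qα − p∣; in each of the three cases this
-- yields Q₀ ≤ 2 v₀ Q₂.  The value v₀ persists up to Q₁ − 1 and v₁ up to Q₂ − 1, so
-- v₀ ≪ Q₁^(−a) and v₁ ≪ Q₂^(−a) for every a < ϖ − 1.  If both ordinary exponents
-- were below 1 + b, also v₀ ≫ Q₀^(−b) and v₁ ≫ Q₁^(−b).  Eliminating Q₁, Q₂, v₀, v₁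
-- with Q₀ arbitrarily large gives b² ≥ a²(b + 1), which says G(1 + b) ≥ 0 in the
-- limit a → ϖ − 1.  Finally G(ϖ) = −(ϖ − 1)³ < 0 gives ϖ < 𝔤.
--
-- Only rational exponents a = A/N and b = B/N are used, and the inequalities are
-- raised to the N-th power, so that no algebra of real powers is needed.

open import Defs
open import Axiom.ExcludedMiddle using (ExcludedMiddle)
open import Level using (0ℓ)
open import Algebra.Bundles using (CommutativeRing)
open import Algebra.Solver.Ring.AlmostCommutativeRing
  using (fromCommutativeRing; _-Raw-AlmostCommutative⟶_)
open import Data.Bool.Base using (Bool; true; false)
open import Data.Empty using (⊥; ⊥-elim)
open import Data.Integer.Base as ℤ using (ℤ; +_; -[1+_])
import Data.Integer.GCD as ℤ
import Data.Integer.Properties as ℤ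
open import Data.Maybe.Base using (just; nothing)
open import Data.Nat.Base as ℕ using (ℕ; zero; suc; z≤n; s≤s)
import Data.Nat.GCD as ℕ
import Data.Nat.Properties as ℕ
open import Data.Product using (∃; _×_; _,_; proj₁; proj₂)
open import Data.Rational.Base as ℚ using (mkℚ; ↥_; ↧_)
import Data.Rational.Properties as ℚ
import Data.Sign.Base as Sign
open import Data.Sum.Base using (_⊎_; inj₁; inj₂; [_,_]′)
open import Function.Base using (_∘_; case_of_)
open import Relation.Binary.Bundles using (TotalOrder)
open import Relation.Binary.Definitions using (WeaklyDecidable)
open import Relation.Binary.PropositionalEquality as ≡ using (_≡_)
open import Relation.Nullary using (¬_; yes; no)
open import Relation.Nullary.Construct.Add.Extrema using (⊥±; ⊤±; [_])
import Relation.Binary.Construct.Add.Supremum.NonStrict as Sup using ([_])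
import Relation.Binary.Construct.Add.Extrema.NonStrict as NonStrictExtrema
import Relation.Binary.Construct.Add.Extrema.Strict as StrictExtrema
open import Relation.Nullary.Decidable using (decidable-stable)
import Algebra.Properties.Ring as RingProperties
import Algebra.Properties.Semiring.Mult as SemiringMult
import Algebra.Properties.CommutativeSemiring.Exp as Exp
import Algebra.Solver.Ring as RingSolver
import Data.Nat.Tactic.RingSolver as ℕSolver
import Relation.Binary.Construct.NonStrictToStrict as ToStrict
import Relation.Binary.Reasoning.PartialOrder as PosetReasoning
import Algebra.Construct.NaturalChoice.Max as Max
import Algebra.Construct.NaturalChoice.Min as Min

module Proof (lem : ExcludedMiddle 0ℓ) (R : CompleteOrderedField) where

  open Exponents lem R
  open RingProperties ring
    using (-0#≈0#; -‿distribˡ-*; -‿distribʳ-*; -‿+-comm; -‿involutive)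
  open SemiringMult semiring using (×1-homo-*; ×-homo-+)
  open Exp commutativeSemiring using (^-homo-*; ^-assocʳ; ^-distrib-*; ^-congˡ)
  open TotalOrder totalOrder using (poset; antisym; total; ≤-respˡ-≈; ≤-respʳ-≈)
    renaming (refl to ≤-refl; trans to ≤-trans; reflexive to ≤-reflexive)
  open Max totalOrder using (x≤x⊔y; x≤y⊔x; ⊔-sel)
  open Min totalOrder using (x⊓y≤x; x⊓y≤y; ⊓-sel)
  open NonStrictExtrema _≤_ using (⊥±≤_; ⊥±≤[_]; [_]≤⊤±; ⊤±≤⊤±; [≤]-injective) renaming ([_] to [_]≤)
  open StrictExtrema _<_ using (⊥±<⊤±; [_]<⊤±)
  private module Max± = Max ℝ±-totalOrder
  open PosetReasoning poset

  fromℕ-homo-+ : ∀ m n → fromℕ (m ℕ.+ n) ≈ fromℕ m + fromℕ n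
  fromℕ-homo-+ m n = ×-homo-+ 1# m n

  fromℕ-homo-* : ∀ m n → fromℕ (m ℕ.* n) ≈ fromℕ m * fromℕ n
  fromℕ-homo-* = ×1-homo-*

  fromℕ-1 : fromℕ 1 ≈ 1#
  fromℕ-1 = +-identityʳ 1#

  fromℤ-homo-‿- : ∀ i → fromℤ (ℤ.- i) ≈ - fromℤ i
  fromℤ-homo-‿- (+ zero)  = sym -0#≈0#
  fromℤ-homo-‿- (+ suc n) = refl
  fromℤ-homo-‿- -[1+ n ]  = sym (-‿involutive _)

  fromℤ-homo-⊖ : ∀ m n → fromℤ (m ℤ.⊖ n) ≈ fromℕ m - fromℕ n
  fromℤ-homo-⊖ m       zero    = sym (trans (+-congˡ -0#≈0#) (+-identityʳ _))
  fromℤ-homo-⊖ zero    (suc n) = sym (+-identityˡ _)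
  fromℤ-homo-⊖ (suc m) (suc n) = begin-equality
    fromℤ (suc m ℤ.⊖ suc n)            ≡⟨ ≡.cong fromℤ (ℤ.[1+m]⊖[1+n]≡m⊖n m n) ⟩
    fromℤ (m ℤ.⊖ n)                    ≈⟨ fromℤ-homo-⊖ m n ⟩
    a - b                              ≈⟨ +-congʳ (+-identityˡ a) ⟨
    0# + a - b                         ≈⟨ +-congʳ (+-congʳ (-‿inverseʳ 1#)) ⟨
    1# - 1# + a - b                    ≈⟨ +-congʳ (trans (+-assoc _ _ _) (+-congˡ (+-comm _ _))) ⟩
    1# + (a - 1#) - b                  ≈⟨ +-congʳ (+-assoc _ _ _) ⟨
    1# + a - 1# - b                    ≈⟨ +-assoc _ _ _ ⟩
    1# + a + (- 1# - b)                ≈⟨ +-congˡ (-‿+-comm 1# b) ⟩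
    1# + a - (1# + b)                  ∎
    where a = fromℕ m
          b = fromℕ n

  fromℤ-homo-+ : ∀ i j → fromℤ (i ℤ.+ j) ≈ fromℤ i + fromℤ j
  fromℤ-homo-+ (+ m)    (+ n)    = fromℕ-homo-+ m n
  fromℤ-homo-+ (+ m)    -[1+ n ] = fromℤ-homo-⊖ m (suc n)
  fromℤ-homo-+ -[1+ m ] (+ n)    = trans (fromℤ-homo-⊖ n (suc m)) (+-comm _ _)
  fromℤ-homo-+ -[1+ m ] -[1+ n ] = begin-equality
    - fromℕ (suc (suc (m ℕ.+ n)))         ≡⟨ ≡.cong (λ k → - fromℕ k) (ℕ.+-suc (suc m) n) ⟨
    - fromℕ (suc m ℕ.+ suc n)             ≈⟨ -‿cong (fromℕ-homo-+ (suc m) (suc n)) ⟩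
    - (fromℕ (suc m) + fromℕ (suc n))     ≈⟨ -‿+-comm _ _ ⟨
    - fromℕ (suc m) - fromℕ (suc n)       ∎

  fromℤ-+◃ : ∀ n → fromℤ (Sign.+ ℤ.◃ n) ≈ fromℕ n
  fromℤ-+◃ n = reflexive (≡.cong fromℤ (ℤ.+◃n≡+n n))

  fromℤ--◃ : ∀ n → fromℤ (Sign.- ℤ.◃ n) ≈ - fromℕ n
  fromℤ--◃ n = trans (reflexive (≡.cong fromℤ (ℤ.-◃n≡-n n))) (fromℤ-homo-‿- (+ n))

  fromℤ-homo-* : ∀ i j → fromℤ (i ℤ.* j) ≈ fromℤ i * fromℤ j
  fromℤ-homo-* (+ m)    (+ n)    = trans (fromℤ-+◃ (m ℕ.* n)) (fromℕ-homo-* m n)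
  fromℤ-homo-* (+ m)    -[1+ n ] =
    trans (fromℤ--◃ (m ℕ.* suc n)) (trans (-‿cong (fromℕ-homo-* m (suc n))) (-‿distribʳ-* _ _))
  fromℤ-homo-* -[1+ m ] (+ n)    =
    trans (fromℤ--◃ (suc m ℕ.* n)) (trans (-‿cong (fromℕ-homo-* (suc m) n)) (-‿distribˡ-* _ _))
  fromℤ-homo-* -[1+ m ] -[1+ n ] = begin-equality
    fromℕ (suc m ℕ.* suc n)                ≈⟨ fromℕ-homo-* (suc m) (suc n) ⟩
    fromℕ (suc m) * fromℕ (suc n)          ≈⟨ -‿involutive _ ⟨
    - - (fromℕ (suc m) * fromℕ (suc n))    ≈⟨ -‿cong (-‿distribˡ-* _ _) ⟩
    - (- fromℕ (suc m) * fromℕ (suc n))    ≈⟨ -‿distribʳ-* _ _ ⟩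
    - fromℕ (suc m) * - fromℕ (suc n)      ∎

  module Solver where
    -- fromℤ, except that con (+ 1) has to denote 1# rather than 1# + 0#.
    ⟦_⟧ℤ : ℤ → ℝ
    ⟦ + 1 ⟧ℤ = 1#
    ⟦ i   ⟧ℤ = fromℤ i

    ⟦⟧ℤ≈fromℤ : ∀ i → ⟦ i ⟧ℤ ≈ fromℤ i
    ⟦⟧ℤ≈fromℤ (+ 0)           = refl
    ⟦⟧ℤ≈fromℤ (+ 1)           = sym fromℕ-1
    ⟦⟧ℤ≈fromℤ (+ suc (suc n)) = refl
    ⟦⟧ℤ≈fromℤ -[1+ n ]        = refl

    morphism : CommutativeRing.rawRing ℤ.+-*-commutativeRing
                 -Raw-AlmostCommutative⟶ fromCommutativeRing commutativeRing
    morphism = record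
      { ⟦_⟧    = ⟦_⟧ℤ
      ; +-homo = λ i j → trans (⟦⟧ℤ≈fromℤ (i ℤ.+ j)) (trans (fromℤ-homo-+ i j)
                   (sym (+-cong (⟦⟧ℤ≈fromℤ i) (⟦⟧ℤ≈fromℤ j))))
      ; *-homo = λ i j → trans (⟦⟧ℤ≈fromℤ (i ℤ.* j)) (trans (fromℤ-homo-* i j)
                   (sym (*-cong (⟦⟧ℤ≈fromℤ i) (⟦⟧ℤ≈fromℤ j))))
      ; -‿homo = λ i → trans (⟦⟧ℤ≈fromℤ (ℤ.- i)) (trans (fromℤ-homo-‿- i)
                   (sym (-‿cong (⟦⟧ℤ≈fromℤ i))))
      ; 0-homo = refl
      ; 1-homo = refl
      }

    _≟_ : WeaklyDecidable (λ i j → ⟦ i ⟧ℤ ≈ ⟦ j ⟧ℤ)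
    i ≟ j with i ℤ.≟ j
    ... | yes eq = just (reflexive (≡.cong ⟦_⟧ℤ eq))
    ... | no  _  = nothing

    open RingSolver (CommutativeRing.rawRing ℤ.+-*-commutativeRing)
      (fromCommutativeRing commutativeRing) morphism _≟_ public

  open Solver using (solve; _:+_; _:*_; _:-_; :-_; _:=_; con; _:^_)

  -- Order and powers

  ≰⇒> : ∀ {x y} → ¬ (x ≤ y) → y < x
  ≰⇒> = ToStrict.≰⇒> _≈_ _≤_ sym ≤-reflexive total

  <⇒≱ : ∀ {x y} → x < y → ¬ (y ≤ x)
  <⇒≱ = ToStrict.<⇒≱ _≈_ _≤_ antisym

  <⇒≤ : ∀ {x y} → x < y → x ≤ y
  <⇒≤ = proj₁

  ≤-<-trans : ∀ {x y z} → x ≤ y → y < z → x < z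
  ≤-<-trans = ToStrict.≤-<-trans _≈_ _≤_ ≤-trans antisym ≤-respˡ-≈

  <-≤-trans : ∀ {x y z} → x < y → y ≤ z → x < z
  <-≤-trans = ToStrict.<-≤-trans _≈_ _≤_ sym ≤-trans antisym ≤-respʳ-≈

  <-trans : ∀ {x y z} → x < y → y < z → x < z
  <-trans x<y = ≤-<-trans (<⇒≤ x<y)

  <-respˡ-≈ : ∀ {x y z} → x ≈ y → x < z → y < z
  <-respˡ-≈ x≈y = ≤-<-trans (≤-reflexive (sym x≈y))

  <-respʳ-≈ : ∀ {x y z} → y ≈ z → x < y → x < z
  <-respʳ-≈ y≈z x<y = <-≤-trans x<y (≤-reflexive y≈z)

  ≤-cong : ∀ {x y x′ y′} → x ≈ x′ → y ≈ y′ → x ≤ y → x′ ≤ y′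
  ≤-cong x≈x′ y≈y′ = ≤-respˡ-≈ x≈x′ ∘ ≤-respʳ-≈ y≈y′

  <-cong : ∀ {x y x′ y′} → x ≈ x′ → y ≈ y′ → x < y → x′ < y′
  <-cong x≈x′ y≈y′ = <-respˡ-≈ x≈x′ ∘ <-respʳ-≈ y≈y′

  +-monoˡ-≤ : ∀ z {x y} → x ≤ y → x + z ≤ y + z
  +-monoˡ-≤ z x≤y = ≤-cong (+-comm _ _) (+-comm _ _) (+-monoʳ-≤ z _ _ x≤y)

  +-mono-≤ : ∀ {x y u v} → x ≤ y → u ≤ v → x + u ≤ y + v
  +-mono-≤ {y = y} {u} x≤y u≤v = ≤-trans (+-monoˡ-≤ u x≤y) (+-monoʳ-≤ y _ _ u≤v)

  +-nonNeg : ∀ {x y} → 0# ≤ x → 0# ≤ y → 0# ≤ x + y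
  +-nonNeg 0≤x 0≤y = ≤-respˡ-≈ (+-identityˡ 0#) (+-mono-≤ 0≤x 0≤y)

  x≤y⇒0≤y-x : ∀ {x y} → x ≤ y → 0# ≤ y - x
  x≤y⇒0≤y-x {x} x≤y = ≤-respˡ-≈ (-‿inverseʳ x) (+-monoˡ-≤ (- x) x≤y)

  0≤y-x⇒x≤y : ∀ {x y} → 0# ≤ y - x → x ≤ y
  0≤y-x⇒x≤y {x} {y} p = ≤-cong (+-identityˡ x)
    (solve 2 (λ x y → y :- x :+ x := y) refl x y) (+-monoˡ-≤ x p)

  certify : ∀ {x y e} → 0# ≤ e → e ≈ y - x → x ≤ y
  certify 0≤e e≈y-x = 0≤y-x⇒x≤y (≤-respʳ-≈ e≈y-x 0≤e)

  -‿anti-mono-≤ : ∀ {x y} → x ≤ y → - y ≤ - x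
  -‿anti-mono-≤ {x} {y} x≤y = certify (x≤y⇒0≤y-x x≤y)
    (solve 2 (λ x y → y :- x := :- x :- (:- y)) refl x y)

  +-cancelʳ-≤ : ∀ z {x y} → x + z ≤ y + z → x ≤ y
  +-cancelʳ-≤ z {x} {y} p = certify (x≤y⇒0≤y-x p)
    (solve 3 (λ x y z → y :+ z :- (x :+ z) := y :- x) refl x y z)

  +-monoˡ-< : ∀ z {x y} → x < y → x + z < y + z
  +-monoˡ-< z x<y = ≰⇒> (<⇒≱ x<y ∘ +-cancelʳ-≤ z)

  x<y⇒0<y-x : ∀ {x y} → x < y → 0# < y - x
  x<y⇒0<y-x {x} x<y = <-respˡ-≈ (-‿inverseʳ x) (+-monoˡ-< (- x) x<y)

  x≤0⇒0≤-x : ∀ {x} → x ≤ 0# → 0# ≤ - x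
  x≤0⇒0≤-x x≤0 = ≤-respˡ-≈ -0#≈0# (-‿anti-mono-≤ x≤0)

  0≤x² : ∀ x → 0# ≤ x * x
  0≤x² x with total 0# x
  ... | inj₁ 0≤x = *-nonNeg x x 0≤x 0≤x
  ... | inj₂ x≤0 = ≤-respʳ-≈ (solve 1 (λ x → :- x :* :- x := x :* x) refl x)
                     (*-nonNeg _ _ (x≤0⇒0≤-x x≤0) (x≤0⇒0≤-x x≤0))

  0<1 : 0# < 1#
  0<1 = ≤-respʳ-≈ (*-identityˡ 1#) (0≤x² 1#) , 0≉1

  0≤1 : 0# ≤ 1#
  0≤1 = <⇒≤ 0<1

  1≤⇒0< : ∀ {x} → 1# ≤ x → 0# < x
  1≤⇒0< = <-≤-trans 0<1

  1≤⇒0≤ : ∀ {x} → 1# ≤ x → 0# ≤ x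
  1≤⇒0≤ = <⇒≤ ∘ 1≤⇒0<

  0<⇒≉0 : ∀ {x} → 0# < x → ¬ (x ≈ 0#)
  0<⇒≉0 (_ , 0≉x) = 0≉x ∘ sym

  *-monoˡ-≤ : ∀ {z x y} → 0# ≤ z → x ≤ y → z * x ≤ z * y
  *-monoˡ-≤ {z} {x} {y} 0≤z x≤y = certify (*-nonNeg z (y - x) 0≤z (x≤y⇒0≤y-x x≤y))
    (solve 3 (λ x y z → z :* (y :- x) := z :* y :- z :* x) refl x y z)

  *-monoʳ-≤ : ∀ {z x y} → 0# ≤ z → x ≤ y → x * z ≤ y * z
  *-monoʳ-≤ 0≤z x≤y = ≤-cong (*-comm _ _) (*-comm _ _) (*-monoˡ-≤ 0≤z x≤y)

  *-mono-≤ : ∀ {x y u v} → 0# ≤ x → 0# ≤ u → x ≤ y → u ≤ v → x * u ≤ y * v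
  *-mono-≤ 0≤x 0≤u x≤y u≤v = ≤-trans (*-monoʳ-≤ 0≤u x≤y) (*-monoˡ-≤ (≤-trans 0≤x x≤y) u≤v)

  x*y≈0⇒y≈0 : ∀ {x y} → ¬ (x ≈ 0#) → x * y ≈ 0# → y ≈ 0#
  x*y≈0⇒y≈0 {x} {y} x≉0 xy≈0 with inverse x x≉0
  ... | z , xz≈1 = begin-equality
    y              ≈⟨ *-identityˡ y ⟨
    1# * y         ≈⟨ *-congʳ xz≈1 ⟨
    x * z * y      ≈⟨ solve 3 (λ x y z → x :* z :* y := z :* (x :* y)) refl x y z ⟩
    z * (x * y)    ≈⟨ *-congˡ xy≈0 ⟩
    z * 0#         ≈⟨ zeroʳ z ⟩
    0#             ∎

  x-y≈0⇒x≈y : ∀ {x y} → x - y ≈ 0# → x ≈ y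
  x-y≈0⇒x≈y {x} {y} p = begin-equality
    x           ≈⟨ solve 2 (λ x y → x := x :- y :+ y) refl x y ⟩
    x - y + y   ≈⟨ +-congʳ p ⟩
    0# + y      ≈⟨ +-identityˡ y ⟩
    y           ∎

  x≈y⇒x-y≈0 : ∀ {x y} → x ≈ y → x - y ≈ 0#
  x≈y⇒x-y≈0 {y = y} x≈y = trans (+-congʳ x≈y) (-‿inverseʳ y)

  *-cancelˡ-≈ : ∀ {z x y} → ¬ (z ≈ 0#) → z * x ≈ z * y → x ≈ y
  *-cancelˡ-≈ {z} {x} {y} z≉0 p = x-y≈0⇒x≈y (x*y≈0⇒y≈0 z≉0
    (trans (solve 3 (λ x y z → z :* (x :- y) := z :* x :- z :* y) refl x y z) (x≈y⇒x-y≈0 p)))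

  *-pos : ∀ {x y} → 0# < x → 0# < y → 0# < x * y
  *-pos 0<x 0<y = *-nonNeg _ _ (<⇒≤ 0<x) (<⇒≤ 0<y) ,
    λ 0≈xy → 0<⇒≉0 0<y (x*y≈0⇒y≈0 (0<⇒≉0 0<x) (sym 0≈xy))

  *-cancelˡ-≤ : ∀ {z x y} → 0# < z → z * x ≤ z * y → x ≤ y
  *-cancelˡ-≤ {z} {x} {y} 0<z zx≤zy with total x y
  ... | inj₁ x≤y = x≤y
  ... | inj₂ y≤x = ≤-reflexive (*-cancelˡ-≈ (0<⇒≉0 0<z) (antisym zx≤zy (*-monoˡ-≤ (<⇒≤ 0<z) y≤x)))

  *-cancelʳ-≤ : ∀ {z x y} → 0# < z → x * z ≤ y * z → x ≤ y
  *-cancelʳ-≤ 0<z p = *-cancelˡ-≤ 0<z (≤-cong (*-comm _ _) (*-comm _ _) p)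

  *-cancelˡ-< : ∀ {z x y} → 0# ≤ z → z * x < z * y → x < y
  *-cancelˡ-< 0≤z p = ≰⇒> (<⇒≱ p ∘ *-monoˡ-≤ 0≤z)

  *-monoˡ-< : ∀ {z x y} → 0# < z → x < y → z * x < z * y
  *-monoˡ-< 0<z x<y = ≰⇒> (<⇒≱ x<y ∘ *-cancelˡ-≤ 0<z)

  *-monoʳ-< : ∀ {z x y} → 0# < z → x < y → x * z < y * z
  *-monoʳ-< 0<z p = <-cong (*-comm _ _) (*-comm _ _) (*-monoˡ-< 0<z p)

  x≤x*y : ∀ {x y} → 0# ≤ x → 1# ≤ y → x ≤ x * y
  x≤x*y {x} 0≤x 1≤y = ≤-respˡ-≈ (*-identityʳ x) (*-monoˡ-≤ 0≤x 1≤y)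

  divide : ∀ {y} x → 0# < y → ∃ λ z → y * z ≈ x
  divide {y} x 0<y with inverse y (0<⇒≉0 0<y)
  ... | z , yz≈1 = z * x , trans (sym (*-assoc y z x)) (trans (*-congʳ yz≈1) (*-identityˡ x))

  1^n≈1 : ∀ n → 1# ^ n ≈ 1#
  1^n≈1 zero    = refl
  1^n≈1 (suc n) = trans (*-identityˡ _) (1^n≈1 n)

  ^-nonNeg : ∀ {x} n → 0# ≤ x → 0# ≤ x ^ n
  ^-nonNeg zero    0≤x = 0≤1
  ^-nonNeg (suc n) 0≤x = *-nonNeg _ _ 0≤x (^-nonNeg n 0≤x)

  ^-pos : ∀ {x} n → 0# < x → 0# < x ^ n
  ^-pos zero    0<x = 0<1
  ^-pos (suc n) 0<x = *-pos 0<x (^-pos n 0<x)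

  ^-monoˡ-≤ : ∀ {x y} n → 0# ≤ x → x ≤ y → x ^ n ≤ y ^ n
  ^-monoˡ-≤ zero    0≤x x≤y = ≤-refl
  ^-monoˡ-≤ (suc n) 0≤x x≤y = *-mono-≤ 0≤x (^-nonNeg n 0≤x) x≤y (^-monoˡ-≤ n 0≤x x≤y)

  1≤^ : ∀ {x} n → 1# ≤ x → 1# ≤ x ^ n
  1≤^ n 1≤x = ≤-respˡ-≈ (1^n≈1 n) (^-monoˡ-≤ n 0≤1 1≤x)

  ^-monoˡ-< : ∀ {x y} n → 0# ≤ x → x < y → x ^ suc n < y ^ suc n
  ^-monoˡ-< {x} {y} n 0≤x x<y = begin-strict
    x * x ^ n   ≤⟨ *-monoˡ-≤ 0≤x (^-monoˡ-≤ n 0≤x (<⇒≤ x<y)) ⟩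
    x * y ^ n   <⟨ *-monoʳ-< (^-pos n (≤-<-trans 0≤x x<y)) x<y ⟩
    y * y ^ n   ∎

  ^-cancel-≤ : ∀ {x y n} → 1 ℕ.≤ n → 0# ≤ y → x ^ n ≤ y ^ n → x ≤ y
  ^-cancel-≤ {x} {y} {suc n} _ 0≤y p with total x y
  ... | inj₁ x≤y = x≤y
  ... | inj₂ y≤x with lem {P = x ≈ y}
  ...   | yes x≈y = ≤-reflexive x≈y
  ...   | no  x≉y = ⊥-elim (<⇒≱ (^-monoˡ-< n 0≤y (y≤x , x≉y ∘ sym)) p)

  ^-monoʳ-≤ : ∀ {x m n} → 1# ≤ x → m ℕ.≤ n → x ^ m ≤ x ^ n
  ^-monoʳ-≤ {n = n} 1≤x z≤n       = 1≤^ n 1≤x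
  ^-monoʳ-≤         1≤x (s≤s m≤n) = *-monoˡ-≤ (1≤⇒0≤ 1≤x) (^-monoʳ-≤ 1≤x m≤n)

  x≤x^n : ∀ {x n} → 1# ≤ x → 1 ℕ.≤ n → x ≤ x ^ n
  x≤x^n {x} 1≤x 1≤n = ≤-respˡ-≈ (*-identityʳ x) (^-monoʳ-≤ 1≤x 1≤n)

  0≤fromℕ : ∀ n → 0# ≤ fromℕ n
  0≤fromℕ zero    = ≤-refl
  0≤fromℕ (suc n) = +-nonNeg 0≤1 (0≤fromℕ n)

  fromℕ-mono-≤ : ∀ {m n} → m ℕ.≤ n → fromℕ m ≤ fromℕ n
  fromℕ-mono-≤ {n = n} z≤n = 0≤fromℕ n
  fromℕ-mono-≤ (s≤s m≤n)   = +-monoʳ-≤ 1# _ _ (fromℕ-mono-≤ m≤n)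

  1≤fromℕ : ∀ {n} → 1 ℕ.≤ n → 1# ≤ fromℕ n
  1≤fromℕ 1≤n = ≤-respˡ-≈ fromℕ-1 (fromℕ-mono-≤ 1≤n)

  0<fromℕ : ∀ {n} → 1 ℕ.≤ n → 0# < fromℕ n
  0<fromℕ = 1≤⇒0< ∘ 1≤fromℕ

  fromℕ-cancel-< : ∀ {m n} → fromℕ m < fromℕ n → m ℕ.< n
  fromℕ-cancel-< p = ℕ.≰⇒> (<⇒≱ p ∘ fromℕ-mono-≤)

  x<1+x : ∀ x → x < 1# + x
  x<1+x x = <-respˡ-≈ (+-identityˡ x) (+-monoˡ-< x 0<1)

  fromℕ-mono-< : ∀ {m n} → m ℕ.< n → fromℕ m < fromℕ n
  fromℕ-mono-< m<n = <-≤-trans (x<1+x _) (fromℕ-mono-≤ m<n)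

  fromℕ-cancel-≤ : ∀ {m n} → fromℕ m ≤ fromℕ n → m ℕ.≤ n
  fromℕ-cancel-≤ p = ℕ.≮⇒≥ (λ n<m → <⇒≱ (fromℕ-mono-< n<m) p)

  ¬∀⇒∃¬ : {A : Set} {P : A → Set} → ¬ (∀ x → P x) → ∃ λ x → ¬ P x
  ¬∀⇒∃¬ {P = P} ¬∀ with lem {P = ∃ λ x → ¬ P x}
  ... | yes ∃¬ = ∃¬
  ... | no ¬∃¬ = ⊥-elim (¬∀ λ x → case lem {P = P x} of λ where
    (yes p) → p
    (no ¬p) → ⊥-elim (¬∃¬ (x , ¬p)))

  abstract
    archimedean : ∀ x → ∃ λ n → x < fromℕ n
    archimedean x with ¬∀⇒∃¬ {P = λ n → fromℕ n ≤ x} unbounded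
      where
      unbounded : ¬ (∀ n → fromℕ n ≤ x)
      unbounded bound with complete fromℕ 0 (x , bound)
      ... | s , ub , least = <⇒≱ (x<1+x (- 1# + s))
        (≤-respˡ-≈ (solve 1 (λ s → s := con (+ 1) :+ (:- con (+ 1) :+ s)) refl s) (least _ below))
        where
        below : ∀ n → fromℕ n ≤ - 1# + s
        below n = certify (x≤y⇒0≤y-x (ub (suc n)))
          (solve 2 (λ n s → s :- (con (+ 1) :+ n) := :- con (+ 1) :+ s :- n) refl (fromℕ n) s)
    ... | n , n≰x = n , ≰⇒> n≰x

  -- Roots and density

  ≮⇒≥ : ∀ {x y} → ¬ (x < y) → y ≤ x
  ≮⇒≥ {x} {y} x≮y with lem {P = y ≤ x}
  ... | yes y≤x = y≤x
  ... | no  y≰x = ⊥-elim (x≮y (≰⇒> y≰x))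

  transition : (P : ℕ → Set) → ¬ P 0 → ∀ n → P n → ∃ λ k → ¬ P k × P (suc k)
  transition P ¬P0 zero    p = ⊥-elim (¬P0 p)
  transition P ¬P0 (suc n) p with lem {P = P n}
  ... | yes q = transition P ¬P0 n q
  ... | no ¬q = n , ¬q , p

  x+x≈2x : ∀ x → x + x ≈ fromℕ 2 * x
  x+x≈2x = solve 1 (λ x → x :+ x := con (+ 2) :* x) refl

  RootBelow : ℕ → ℝ → Set
  RootBelow n t = ∃ λ s → 0# ≤ s × s ^ n ≤ t

  abstract
    floor : ∀ {x} → 0# ≤ x → ∃ λ n → fromℕ n ≤ x × x < fromℕ (suc n)
    floor {x} 0≤x with archimedean x
    ... | m , x<m with transition (λ n → x < fromℕ n) (λ x<0 → <⇒≱ x<0 0≤x) m x<m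
    ... | n , x≮n , x<1+n = n , ≮⇒≥ x≮n , x<1+n

    rationals-dense : ∀ {x y} → 0# ≤ x → x < y →
      ∃ λ m → ∃ λ n → 1 ℕ.≤ n × fromℕ n * x < fromℕ m × fromℕ m < fromℕ n * y
    rationals-dense {x} {y} 0≤x x<y =
      let 0<y-x        = x<y⇒0<y-x x<y
          z , [y-x]z≈1 = divide 1# 0<y-x
          k , z<k      = archimedean z
          ν            = fromℕ (suc k)
          m , m≤νx , νx<1+m = floor (*-nonNeg ν x (0≤fromℕ (suc k)) 0≤x)
          z<ν : z < ν
          z<ν = <-trans z<k (x<1+x (fromℕ k))
          1<ν[y-x] : 1# < ν * (y - x)
          1<ν[y-x] = <-cong [y-x]z≈1 (*-comm (y - x) ν) (*-monoˡ-< 0<y-x z<ν)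
      in suc m , suc k , s≤s z≤n , νx<1+m , (begin-strict
        1# + fromℕ m             ≤⟨ +-monoʳ-≤ 1# (fromℕ m) (ν * x) m≤νx ⟩
        1# + ν * x               <⟨ +-monoˡ-< (ν * x) 1<ν[y-x] ⟩
        ν * (y - x) + ν * x      ≈⟨ solve 3 (λ ν x y → ν :* (y :- x) :+ ν :* x := ν :* y) refl ν x y ⟩
        ν * y                    ∎)

    between : ∀ {x y} → x < y → ∃ λ z → x < z × z < y
    between {x} {y} x<y with divide (x + y) (0<fromℕ {2} (s≤s z≤n))
    ... | z , 2z≈x+y =
      z , *-cancelˡ-< (0≤fromℕ 2) (<-respʳ-≈ (sym 2z≈x+y) (<-cong (x+x≈2x x) (+-comm y x) (+-monoˡ-< x x<y)))
        , *-cancelˡ-< (0≤fromℕ 2) (<-cong (sym 2z≈x+y) (x+x≈2x y) (+-monoˡ-< y x<y))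

    scale-down : ∀ {c l} → 0# < c → 0# ≤ l → ∃ λ δ → 0# < δ × δ ≤ 1# × l * δ ≤ c
    scale-down {c} {l} 0<c 0≤l with divide c 0<c+l
      where
      0<c+l : 0# < c + l
      0<c+l = <-≤-trans 0<c (≤-respˡ-≈ (+-identityʳ c) (+-monoʳ-≤ c _ _ 0≤l))
    ... | δ , [c+l]δ≈c = δ , 0<δ , *-cancelˡ-≤ 0<c+l (begin
        (c + l) * δ    ≈⟨ [c+l]δ≈c ⟩
        c              ≤⟨ c≤c+l ⟩
        c + l          ≈⟨ *-identityʳ _ ⟨
        (c + l) * 1#   ∎) , (begin
        l * δ            ≈⟨ +-identityˡ _ ⟨
        0# + l * δ       ≤⟨ +-monoˡ-≤ _ (*-nonNeg _ _ (<⇒≤ 0<c) (<⇒≤ 0<δ)) ⟩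
        c * δ + l * δ    ≈⟨ distribʳ δ c l ⟨
        (c + l) * δ      ≈⟨ [c+l]δ≈c ⟩
        c                ∎)
      where
      c≤c+l : c ≤ c + l
      c≤c+l = ≤-respˡ-≈ (+-identityʳ c) (+-monoʳ-≤ c _ _ 0≤l)
      0<c+l : 0# < c + l
      0<c+l = <-≤-trans 0<c c≤c+l
      0<δ : 0# < δ
      0<δ = *-cancelˡ-< (<⇒≤ 0<c+l) (<-cong (sym (zeroʳ _)) (sym [c+l]δ≈c) 0<c)

    ^-lipschitz : ∀ n {b} → 0# ≤ b →
      ∃ λ l → 0# ≤ l × (∀ {x y} → 0# ≤ x → x ≤ y → y ≤ b → y ^ n ≤ x ^ n + l * (y - x))
    ^-lipschitz zero    0≤b = 0# , ≤-refl , λ {x} {y} _ _ _ →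
      ≤-reflexive (solve 2 (λ x y → con (+ 1) := con (+ 1) :+ con (+ 0) :* (y :- x)) refl x y)
    ^-lipschitz (suc n) {b} 0≤b with ^-lipschitz n 0≤b
    ... | l , 0≤l , bound = b * l + b ^ n ,
      +-nonNeg (*-nonNeg _ _ 0≤b 0≤l) (^-nonNeg n 0≤b) , λ {x} {y} 0≤x x≤y y≤b →
      let 0≤y-x = x≤y⇒0≤y-x x≤y
          0≤y   = ≤-trans 0≤x x≤y
      in begin
      y * y ^ n                                           ≤⟨ *-monoˡ-≤ 0≤y (bound 0≤x x≤y y≤b) ⟩
      y * (x ^ n + l * (y - x))
        ≈⟨ solve 4 (λ x y u l → y :* (u :+ l :* (y :- x))
               := x :* u :+ (y :* (l :* (y :- x)) :+ u :* (y :- x)))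
             refl x y (x ^ n) l ⟩
      x * x ^ n + (y * (l * (y - x)) + x ^ n * (y - x))
        ≤⟨ +-monoʳ-≤ _ _ _ (+-mono-≤ (*-monoʳ-≤ (*-nonNeg _ _ 0≤l 0≤y-x) y≤b) (*-monoʳ-≤ 0≤y-x (^-monoˡ-≤ n 0≤x (≤-trans x≤y y≤b)))) ⟩
      x * x ^ n + (b * (l * (y - x)) + b ^ n * (y - x))
        ≈⟨ solve 5 (λ u l d b v → u :+ (b :* (l :* d) :+ v :* d) := u :+ (b :* l :+ v) :* d)
             refl (x * x ^ n) l (y - x) b (b ^ n) ⟩
      x * x ^ n + (b * l + b ^ n) * (y - x)               ∎

    ^-increase : ∀ n {s t} → 0# ≤ s → s ^ n < t → ∃ λ s′ → s < s′ × s′ ^ n ≤ t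
    ^-increase n {s} {t} 0≤s s^n<t =
      let l , 0≤l , bound      = ^-lipschitz n (≤-trans 0≤s (<⇒≤ (x<1+x s)))
          δ , 0<δ , δ≤1 , lδ≤  = scale-down (x<y⇒0<y-x s^n<t) 0≤l
          s<δ+s : s < δ + s
          s<δ+s = <-respˡ-≈ (+-identityˡ s) (+-monoˡ-< s 0<δ)
      in δ + s , s<δ+s , (begin
        (δ + s) ^ n                ≤⟨ bound 0≤s (<⇒≤ s<δ+s) (+-monoˡ-≤ s δ≤1) ⟩
        s ^ n + l * (δ + s - s)
          ≈⟨ solve 4 (λ δ s l u → u :+ l :* (δ :+ s :- s) := u :+ l :* δ) refl δ s l (s ^ n) ⟩
        s ^ n + l * δ              ≤⟨ +-monoʳ-≤ (s ^ n) _ _ lδ≤ ⟩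
        s ^ n + (t - s ^ n)        ≈⟨ solve 2 (λ t u → u :+ (t :- u) := t) refl t (s ^ n) ⟩
        t                          ∎)

    ^-decrease : ∀ n {s t} → 0# < s → t < s ^ n → ∃ λ s′ → 0# ≤ s′ × s′ < s × t ≤ s′ ^ n
    ^-decrease n {s} {t} 0<s t<s^n =
      let 0≤s                  = <⇒≤ 0<s
          l , 0≤l , bound      = ^-lipschitz n 0≤s
          δ , 0<δ , δ≤1 , lsδ≤ = scale-down (x<y⇒0<y-x t<s^n) (*-nonNeg l s 0≤l 0≤s)
          x = s - s * δ
          0≤x : 0# ≤ x
          0≤x = x≤y⇒0≤y-x (≤-respʳ-≈ (*-identityʳ s) (*-monoˡ-≤ 0≤s δ≤1))
          x<s : x < s
          x<s = <-cong (+-identityˡ x) (solve 2 (λ s δ → s :* δ :+ (s :- s :* δ) := s) refl s δ)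
                  (+-monoˡ-< x (*-pos 0<s 0<δ))
      in x , 0≤x , x<s , +-cancelʳ-≤ (s ^ n - t) (begin
        t + (s ^ n - t)            ≈⟨ solve 2 (λ t u → t :+ (u :- t) := u) refl t (s ^ n) ⟩
        s ^ n                      ≤⟨ bound 0≤x (<⇒≤ x<s) ≤-refl ⟩
        x ^ n + l * (s - x)
          ≈⟨ solve 4 (λ s l δ u → u :+ l :* (s :- (s :- s :* δ)) := u :+ l :* s :* δ)
               refl s l δ (x ^ n) ⟩
        x ^ n + l * s * δ          ≤⟨ +-monoʳ-≤ (x ^ n) _ _ lsδ≤ ⟩
        x ^ n + (s ^ n - t)        ∎)

    root : ∀ {n t} → 1 ℕ.≤ n → 0# ≤ t → ∃ λ s → 0# ≤ s × s ^ n ≈ t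
    root {suc n} {t} _ 0≤t = from-supremum (complete {RootBelow (suc n) t} proj₁ 0∈Below (1# + t , bounded))
      where
      1≤1+t : 1# ≤ 1# + t
      1≤1+t = ≤-respˡ-≈ (+-identityʳ 1#) (+-monoʳ-≤ 1# _ _ 0≤t)

      bounded : ∀ ((s , _) : RootBelow (suc n) t) → s ≤ 1# + t
      bounded (s , 0≤s , s^n≤t) = ≮⇒≥ λ 1+t<s → <⇒≱ (x<1+x t) (begin
        1# + t              ≤⟨ x≤x^n {n = suc n} 1≤1+t (s≤s z≤n) ⟩
        (1# + t) ^ suc n    ≤⟨ ^-monoˡ-≤ (suc n) (1≤⇒0≤ 1≤1+t) (<⇒≤ 1+t<s) ⟩
        s ^ suc n           ≤⟨ s^n≤t ⟩
        t                   ∎)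

      0^n≤t : 0# ^ suc n ≤ t
      0^n≤t = ≤-respˡ-≈ (sym (zeroˡ (0# ^ n))) 0≤t

      0∈Below : RootBelow (suc n) t
      0∈Below = 0# , ≤-refl , 0^n≤t

      from-supremum : ∃ (Bounds.IsSupremum _≤_ {RootBelow (suc n) t} proj₁) → ∃ λ s → 0# ≤ s × s ^ suc n ≈ t
      from-supremum (S , ub , least) = S , 0≤S , antisym (≮⇒≥ t≮S^n) (≮⇒≥ S^n≮t)
        where
        0≤S : 0# ≤ S
        0≤S = ub 0∈Below

        S^n≮t : ¬ (S ^ suc n < t)
        S^n≮t S^n<t =
          let s , S<s , s^n≤t = ^-increase (suc n) 0≤S S^n<t
          in <⇒≱ S<s (ub (s , ≤-trans 0≤S (<⇒≤ S<s) , s^n≤t))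

        t≮S^n : ¬ (t < S ^ suc n)
        t≮S^n t<S^n =
          let 0<S : 0# < S
              0<S = ≰⇒> λ S≤0 → <⇒≱ t<S^n (≤-trans (^-monoˡ-≤ (suc n) 0≤S S≤0) 0^n≤t)
              x , 0≤x , x<S , t≤x^n = ^-decrease (suc n) 0<S t<S^n
          in <⇒≱ x<S (least x λ (s , 0≤s , s^n≤t) →
               ≮⇒≥ λ x<s → <⇒≱ (^-monoˡ-< n 0≤x x<s) (≤-trans s^n≤t t≤x^n))

  -- Three consecutive records

  w*p≤c∧1≤w*r⇒p≤c*r : ∀ {w p c r} → 0# ≤ p → 0# ≤ r → w * p ≤ c → 1# ≤ w * r → p ≤ c * r
  w*p≤c∧1≤w*r⇒p≤c*r {w} {p} {c} {r} 0≤p 0≤r wp≤c 1≤wr = begin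
    p              ≤⟨ x≤x*y 0≤p 1≤wr ⟩
    p * (w * r)    ≈⟨ solve 3 (λ w p r → p :* (w :* r) := w :* p :* r) refl w p r ⟩
    w * p * r      ≤⟨ *-monoʳ-≤ 0≤r wp≤c ⟩
    c * r          ∎

  ^-^-comm : ∀ x m n → (x ^ m) ^ n ≈ (x ^ n) ^ m
  ^-^-comm x m n = trans (^-assocʳ x m n)
    (trans (reflexive (≡.cong (x ^_) (ℕ.*-comm m n))) (sym (^-assocʳ x n m)))

  module _ {A B N : ℕ} (1≤A : 1 ℕ.≤ A) (1≤N : 1 ℕ.≤ N) {C : ℝ} (0≤C : 0# ≤ C) where

    private
      D E : ℝ
      D = fromℕ 2 ^ N * C
      E = D ^ A * C ^ N

      0≤D : 0# ≤ D
      0≤D = *-nonNeg _ _ (^-nonNeg N (0≤fromℕ 2)) 0≤C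

    -- x, y, z are the denominators of consecutive records and v₀, v₁ their first two qualities.
    record Triple (x y z v₀ v₁ : ℝ) : Set where
      field
        1≤x    : 1# ≤ x
        1≤y    : 1# ≤ y
        1≤z    : 1# ≤ z
        0≤v₀   : 0# ≤ v₀
        v₀y≤C  : v₀ ^ N * y ^ A ≤ C
        v₁z≤C  : v₁ ^ N * z ^ A ≤ C
        1≤v₀x  : 1# ≤ v₀ ^ N * x ^ B
        1≤v₁y  : 1# ≤ v₁ ^ N * y ^ B
        x≤2v₀z : x ≤ fromℕ 2 * v₀ * z

    module _ {x y z v₀ v₁ : ℝ} (t : Triple x y z v₀ v₁) where

      open Triple t

      private
        0≤x = 1≤⇒0≤ 1≤x
        0≤y = 1≤⇒0≤ 1≤y
        0≤z = 1≤⇒0≤ 1≤z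

      y-bound : y ^ A ≤ C * x ^ B
      y-bound = w*p≤c∧1≤w*r⇒p≤c*r (^-nonNeg A 0≤y) (^-nonNeg B 0≤x) v₀y≤C 1≤v₀x

      z-bound : z ^ A ≤ C * y ^ B
      z-bound = w*p≤c∧1≤w*r⇒p≤c*r (^-nonNeg A 0≤z) (^-nonNeg B 0≤y) v₁z≤C 1≤v₁y

      xy-bound : x ^ N * y ^ A ≤ D * z ^ N
      xy-bound = begin
        x ^ N * y ^ A                                ≤⟨ *-monoʳ-≤ (^-nonNeg A 0≤y) (^-monoˡ-≤ N 0≤x x≤2v₀z) ⟩
        (fromℕ 2 * v₀ * z) ^ N * y ^ A
          ≈⟨ *-congʳ (trans (^-distrib-* _ z N) (*-congʳ (^-distrib-* (fromℕ 2) v₀ N))) ⟩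
        fromℕ 2 ^ N * v₀ ^ N * z ^ N * y ^ A
          ≈⟨ solve 4 (λ t v z y → t :* v :* z :* y := t :* (v :* y) :* z)
               refl (fromℕ 2 ^ N) (v₀ ^ N) (z ^ N) (y ^ A) ⟩
        fromℕ 2 ^ N * (v₀ ^ N * y ^ A) * z ^ N
          ≤⟨ *-monoʳ-≤ (^-nonNeg N 0≤z) (*-monoˡ-≤ (^-nonNeg N (0≤fromℕ 2)) v₀y≤C) ⟩
        D * z ^ N                                    ∎

      combined : (x ^ N) ^ A * y ^ (A ℕ.* A) ≤ E * y ^ (B ℕ.* N)
      combined = begin
        (x ^ N) ^ A * y ^ (A ℕ.* A)    ≈⟨ *-congˡ (^-assocʳ y A A) ⟨
        (x ^ N) ^ A * (y ^ A) ^ A      ≈⟨ ^-distrib-* (x ^ N) (y ^ A) A ⟨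
        (x ^ N * y ^ A) ^ A
          ≤⟨ ^-monoˡ-≤ A (*-nonNeg _ _ (^-nonNeg N 0≤x) (^-nonNeg A 0≤y)) xy-bound ⟩
        (D * z ^ N) ^ A                ≈⟨ ^-distrib-* D (z ^ N) A ⟩
        D ^ A * (z ^ N) ^ A            ≈⟨ *-congˡ (^-^-comm z N A) ⟩
        D ^ A * (z ^ A) ^ N            ≤⟨ *-monoˡ-≤ (^-nonNeg A 0≤D) (^-monoˡ-≤ N (^-nonNeg A 0≤z) z-bound) ⟩
        D ^ A * (C * y ^ B) ^ N        ≈⟨ *-congˡ (^-distrib-* C (y ^ B) N) ⟩
        D ^ A * (C ^ N * (y ^ B) ^ N)  ≈⟨ *-congˡ (*-congˡ (^-assocʳ y B N)) ⟩
        D ^ A * (C ^ N * y ^ (B ℕ.* N))  ≈⟨ *-assoc _ _ _ ⟨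
        E * y ^ (B ℕ.* N)              ∎

      bound-small-B : ∀ k → A ℕ.* A ≡ B ℕ.* N ℕ.+ k → x ≤ E
      bound-small-B k A²≡BN+k = ≤-trans (≤-trans (x≤x^n 1≤x 1≤N) (x≤x^n (1≤^ N 1≤x) 1≤A))
        (*-cancelʳ-≤ {z = y ^ (B ℕ.* N)} (^-pos (B ℕ.* N) (1≤⇒0< 1≤y)) (begin
          (x ^ N) ^ A * y ^ (B ℕ.* N)
            ≤⟨ *-monoˡ-≤ (^-nonNeg A (^-nonNeg N 0≤x)) (^-monoʳ-≤ 1≤y (≡.subst (B ℕ.* N ℕ.≤_) (≡.sym A²≡BN+k) (ℕ.m≤m+n (B ℕ.* N) k))) ⟩
          (x ^ N) ^ A * y ^ (A ℕ.* A)   ≤⟨ combined ⟩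
          E * y ^ (B ℕ.* N)             ∎))

      bound-large-B : ∀ k j → B ℕ.* N ≡ A ℕ.* A ℕ.+ k → N ℕ.* A ℕ.* A ≡ B ℕ.* k ℕ.+ suc j →
        x ≤ E ^ A * C ^ k
      bound-large-B k j BN≡A²+k NA²≡Bk+1+j = *-cancelʳ-≤ {z = x ^ (B ℕ.* k)} (^-pos (B ℕ.* k) (1≤⇒0< 1≤x)) (begin
        x * x ^ (B ℕ.* k)
          ≤⟨ *-monoʳ-≤ (^-nonNeg (B ℕ.* k) 0≤x) (x≤x^n 1≤x (s≤s (z≤n {j}))) ⟩
        x ^ suc j * x ^ (B ℕ.* k)           ≈⟨ *-comm _ _ ⟩
        x ^ (B ℕ.* k) * x ^ suc j           ≈⟨ ^-homo-* x (B ℕ.* k) (suc j) ⟨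
        x ^ (B ℕ.* k ℕ.+ suc j)             ≡⟨ ≡.cong (x ^_) NA²≡Bk+1+j ⟨
        x ^ (N ℕ.* A ℕ.* A)                 ≈⟨ ^-assocʳ x (N ℕ.* A) A ⟨
        (x ^ (N ℕ.* A)) ^ A                 ≈⟨ ^-congˡ A (^-assocʳ x N A) ⟨
        ((x ^ N) ^ A) ^ A                   ≤⟨ ^-monoˡ-≤ A (^-nonNeg A (^-nonNeg N 0≤x)) x^NA≤Ey^k ⟩
        (E * y ^ k) ^ A                     ≈⟨ ^-distrib-* E (y ^ k) A ⟩
        E ^ A * (y ^ k) ^ A                 ≈⟨ *-congˡ (^-^-comm y k A) ⟩
        E ^ A * (y ^ A) ^ k
          ≤⟨ *-monoˡ-≤ (^-nonNeg A 0≤E) (^-monoˡ-≤ k (^-nonNeg A 0≤y) y-bound) ⟩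
        E ^ A * (C * x ^ B) ^ k
          ≈⟨ *-congˡ (trans (^-distrib-* C (x ^ B) k) (*-congˡ (^-assocʳ x B k))) ⟩
        E ^ A * (C ^ k * x ^ (B ℕ.* k))     ≈⟨ *-assoc _ _ _ ⟨
        E ^ A * C ^ k * x ^ (B ℕ.* k)       ∎)
        where
        0≤E : 0# ≤ E
        0≤E = *-nonNeg _ _ (^-nonNeg A 0≤D) (^-nonNeg N 0≤C)
        x^NA≤Ey^k : (x ^ N) ^ A ≤ E * y ^ k
        x^NA≤Ey^k = *-cancelʳ-≤ {z = y ^ (A ℕ.* A)} (^-pos (A ℕ.* A) (1≤⇒0< 1≤y)) (begin
          (x ^ N) ^ A * y ^ (A ℕ.* A)        ≤⟨ combined ⟩
          E * y ^ (B ℕ.* N)                  ≡⟨ ≡.cong (λ n → E * y ^ n) BN≡A²+k ⟩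
          E * y ^ (A ℕ.* A ℕ.+ k)            ≈⟨ *-congˡ (trans (^-homo-* y (A ℕ.* A) k) (*-comm _ _)) ⟩
          E * (y ^ k * y ^ (A ℕ.* A))        ≈⟨ *-assoc _ _ _ ⟨
          E * y ^ k * y ^ (A ℕ.* A)          ∎)

    abstract
      triples-bounded : B ℕ.* B ℕ.* N ℕ.< A ℕ.* A ℕ.* (B ℕ.+ N) →
        ∃ λ K → ∀ {x y z v₀ v₁} → Triple x y z v₀ v₁ → x ≤ K
      triples-bounded B²N<A²[B+N] with ℕ.≤-total (A ℕ.* A) (B ℕ.* N)
      ... | inj₂ BN≤A² =
        let k , A²≡ = ℕ.m≤n⇒∃[o]m+o≡n BN≤A²
        in E , λ t → bound-small-B t k (≡.sym A²≡)
      ... | inj₁ A²≤BN =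
        let k , BN≡ = ℕ.m≤n⇒∃[o]m+o≡n A²≤BN
            Bk<NA² : B ℕ.* k ℕ.< N ℕ.* A ℕ.* A
            Bk<NA² = ℕ.+-cancelˡ-< (A ℕ.* A ℕ.* B) _ _ (≡.subst₂ ℕ._<_
              (≡.trans (ℕ.*-assoc B B N) (≡.trans (≡.cong (B ℕ.*_) (≡.sym BN≡)) (expand A B k)))
              (rearrange A B N) B²N<A²[B+N])
            j , NA²≡ = ℕ.m≤n⇒∃[o]m+o≡n Bk<NA²
        in E ^ A * C ^ k , λ t → bound-large-B t k j (≡.sym BN≡)
            (≡.trans (≡.sym NA²≡) (≡.sym (ℕ.+-suc (B ℕ.* k) j)))
        where
        expand : ∀ A B k → B ℕ.* (A ℕ.* A ℕ.+ k) ≡ A ℕ.* A ℕ.* B ℕ.+ B ℕ.* k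
        expand = ℕSolver.solve-∀
        rearrange : ∀ A B N → A ℕ.* A ℕ.* (B ℕ.+ N) ≡ A ℕ.* A ℕ.* B ℕ.+ N ℕ.* A ℕ.* A
        rearrange = ℕSolver.solve-∀

  -- Approximation by fractions

  x≤∣x∣ : ∀ x → x ≤ ∣ x ∣
  x≤∣x∣ x = x≤x⊔y x (- x)

  -x≤∣x∣ : ∀ x → - x ≤ ∣ x ∣
  -x≤∣x∣ x = x≤y⊔x x (- x)

  ∣x∣≤y : ∀ {x y} → x ≤ y → - x ≤ y → ∣ x ∣ ≤ y
  ∣x∣≤y {x} x≤y -x≤y = [ (λ eq → ≤-respˡ-≈ (sym eq) x≤y) , (λ eq → ≤-respˡ-≈ (sym eq) -x≤y) ]′ (⊔-sel x (- x))

  0≤∣x∣ : ∀ x → 0# ≤ ∣ x ∣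
  0≤∣x∣ x with total 0# x
  ... | inj₁ 0≤x = ≤-trans 0≤x (x≤∣x∣ x)
  ... | inj₂ x≤0 = ≤-trans (x≤0⇒0≤-x x≤0) (-x≤∣x∣ x)

  ∣x∣≈0⇒x≈0 : ∀ {x} → ∣ x ∣ ≈ 0# → x ≈ 0#
  ∣x∣≈0⇒x≈0 {x} ∣x∣≈0 = antisym (≤-respʳ-≈ ∣x∣≈0 (x≤∣x∣ x))
    (≤-cong -0#≈0# (-‿involutive x) (-‿anti-mono-≤ (≤-respʳ-≈ ∣x∣≈0 (-x≤∣x∣ x))))

  module _ (α : ℝ) where

    error : ℕ → ℤ → ℝ
    error q p = fromℕ q * α - fromℤ p

    cross : ∀ q p q′ p′ →
      fromℕ q * error q′ p′ - fromℕ q′ * error q p ≈ fromℤ (+ q′ ℤ.* p ℤ.- + q ℤ.* p′)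
    cross q p q′ p′ = begin-equality
      fromℕ q * error q′ p′ - fromℕ q′ * error q p
        ≈⟨ solve 5 (λ α q q′ p p′ → q :* (q′ :* α :- p′) :- q′ :* (q :* α :- p) := q′ :* p :- q :* p′) refl
             α (fromℕ q) (fromℕ q′) (fromℤ p) (fromℤ p′) ⟩
      fromℕ q′ * fromℤ p - fromℕ q * fromℤ p′
        ≈⟨ +-cong (fromℤ-homo-* (+ q′) p) (trans (fromℤ-homo-‿- (+ q ℤ.* p′)) (-‿cong (fromℤ-homo-* (+ q) p′))) ⟨
      fromℤ (+ q′ ℤ.* p) + fromℤ (ℤ.- (+ q ℤ.* p′))
        ≈⟨ fromℤ-homo-+ (+ q′ ℤ.* p) (ℤ.- (+ q ℤ.* p′)) ⟨
      fromℤ (+ q′ ℤ.* p ℤ.- + q ℤ.* p′) ∎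

    -- Distinct fractions p/q and p′/q′ satisfy 1 ≤ ∣q′p − qp′∣, whereas equal
    -- fractions with q ≤ q′ would give an error at q′ no smaller than at q.
    repulsion : ∀ q p q′ p′ → 1 ℕ.≤ q → q ℕ.≤ q′ →
      fromℕ q′ * ∣ error q′ p′ ∣ < fromℕ q * ∣ error q p ∣ →
      fromℕ 2 * (fromℕ q′ * ∣ error q′ p′ ∣) ≤ 1# →
      1# ≤ fromℕ 2 * (fromℕ q′ * ∣ error q p ∣)
    repulsion q p q′ p′ 1≤q q≤q′ smaller 2q′e′≤1 = go (+ q′ ℤ.* p ℤ.- + q ℤ.* p′) (cross q p q′ p′)
      where
      e = error q p
      e′ = error q′ p′
      0≤q = 0≤fromℕ q
      0≤q′ = 0≤fromℕ q′

      distinct : 1# ≤ fromℕ q * ∣ e′ ∣ + fromℕ q′ * ∣ e ∣ → 1# ≤ fromℕ 2 * (fromℕ q′ * ∣ e ∣)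
      distinct 1≤ = +-cancelʳ-≤ 1# (begin
        1# + 1#                                                           ≤⟨ +-mono-≤ 1≤′ 1≤′ ⟩
        fromℕ q′ * ∣ e′ ∣ + fromℕ q′ * ∣ e ∣ + (fromℕ q′ * ∣ e′ ∣ + fromℕ q′ * ∣ e ∣)
          ≈⟨ solve 2 (λ x y → x :+ y :+ (x :+ y) := con (+ 2) :* y :+ con (+ 2) :* x)
               refl (fromℕ q′ * ∣ e′ ∣) (fromℕ q′ * ∣ e ∣) ⟩
        fromℕ 2 * (fromℕ q′ * ∣ e ∣) + fromℕ 2 * (fromℕ q′ * ∣ e′ ∣)      ≤⟨ +-monoʳ-≤ _ _ _ 2q′e′≤1 ⟩
        fromℕ 2 * (fromℕ q′ * ∣ e ∣) + 1#                                 ∎)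
        where
        1≤′ : 1# ≤ fromℕ q′ * ∣ e′ ∣ + fromℕ q′ * ∣ e ∣
        1≤′ = ≤-trans 1≤ (+-monoˡ-≤ (fromℕ q′ * ∣ e ∣) (*-monoʳ-≤ (0≤∣x∣ e′) (fromℕ-mono-≤ q≤q′)))

      go : ∀ i → fromℕ q * e′ - fromℕ q′ * e ≈ fromℤ i → 1# ≤ fromℕ 2 * (fromℕ q′ * ∣ e ∣)
      go (+ zero) eq = ⊥-elim (<⇒≱ smaller (begin
        fromℕ q * ∣ e ∣      ≤⟨ *-monoʳ-≤ (0≤∣x∣ e) (fromℕ-mono-≤ q≤q′) ⟩
        fromℕ q′ * ∣ e ∣     ≤⟨ q′∣e∣≤q∣e′∣ ⟩
        fromℕ q * ∣ e′ ∣     ≤⟨ *-monoʳ-≤ (0≤∣x∣ e′) (fromℕ-mono-≤ q≤q′) ⟩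
        fromℕ q′ * ∣ e′ ∣    ∎))
        where
        qe′≈q′e : fromℕ q * e′ ≈ fromℕ q′ * e
        qe′≈q′e = x-y≈0⇒x≈y eq
        q′∣e∣≤q∣e′∣ : fromℕ q′ * ∣ e ∣ ≤ fromℕ q * ∣ e′ ∣
        q′∣e∣≤q∣e′∣ = [ (λ ∣e∣≈e → begin
            fromℕ q′ * ∣ e ∣     ≈⟨ *-congˡ ∣e∣≈e ⟩
            fromℕ q′ * e         ≈⟨ qe′≈q′e ⟨
            fromℕ q * e′         ≤⟨ *-monoˡ-≤ 0≤q (x≤∣x∣ e′) ⟩
            fromℕ q * ∣ e′ ∣     ∎)
          , (λ ∣e∣≈-e → begin
            fromℕ q′ * ∣ e ∣     ≈⟨ *-congˡ ∣e∣≈-e ⟩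
            fromℕ q′ * - e       ≈⟨ -‿distribʳ-* _ _ ⟨
            - (fromℕ q′ * e)     ≈⟨ -‿cong qe′≈q′e ⟨
            - (fromℕ q * e′)     ≈⟨ -‿distribʳ-* _ _ ⟩
            fromℕ q * - e′       ≤⟨ *-monoˡ-≤ 0≤q (-x≤∣x∣ e′) ⟩
            fromℕ q * ∣ e′ ∣     ∎) ]′ (⊔-sel e (- e))
      go (+ suc n) eq = distinct (begin
        1#                                        ≤⟨ 1≤fromℕ {suc n} (s≤s z≤n) ⟩
        fromℕ (suc n)                             ≈⟨ eq ⟨
        fromℕ q * e′ - fromℕ q′ * e               ≈⟨ +-congˡ (-‿distribʳ-* _ _) ⟩
        fromℕ q * e′ + fromℕ q′ * - e
          ≤⟨ +-mono-≤ (*-monoˡ-≤ 0≤q (x≤∣x∣ e′)) (*-monoˡ-≤ 0≤q′ (-x≤∣x∣ e)) ⟩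
        fromℕ q * ∣ e′ ∣ + fromℕ q′ * ∣ e ∣       ∎)
      go -[1+ n ] eq = distinct (begin
        1#                                        ≤⟨ 1≤fromℕ {suc n} (s≤s z≤n) ⟩
        fromℕ (suc n)                             ≈⟨ -‿involutive _ ⟨
        - - fromℕ (suc n)                         ≈⟨ -‿cong eq ⟨
        - (fromℕ q * e′ - fromℕ q′ * e)
          ≈⟨ solve 4 (λ q e q′ e′ → :- (q :* e′ :- q′ :* e) := q :* :- e′ :+ q′ :* e)
               refl (fromℕ q) e (fromℕ q′) e′ ⟩
        fromℕ q * - e′ + fromℕ q′ * e
          ≤⟨ +-mono-≤ (*-monoˡ-≤ 0≤q (-x≤∣x∣ e′)) (*-monoˡ-≤ 0≤q′ (x≤∣x∣ e)) ⟩
        fromℕ q * ∣ e′ ∣ + fromℕ q′ * ∣ e ∣       ∎)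

  the-spec : {A : Set} {d : A} {P : A → Set} → ∃ P → P (the d P)
  the-spec {P = P} (x , px) with lem {P = ∃ P}
  ... | yes (_ , py) = py
  ... | no ¬∃        = ⊥-elim (¬∃ (x , px))

  minimum-spec : {I : Set} (f : I → ℝ) → ∀ i → (∀ j → f i ≤ f j) →
    (∃ λ i → minimum f ≈ f i) × Bounds.IsLowerBound _≤_ f (minimum f)
  minimum-spec f i least = the-spec
    {P = λ x → (∃ λ i → x ≈ f i) × Bounds.IsLowerBound _≤_ f x} (f i , (i , refl) , least)

  fromℤ-mono-≤ : ∀ {i j} → i ℤ.≤ j → fromℤ i ≤ fromℤ j
  fromℤ-mono-≤ (ℤ.-≤- n≤m)         = -‿anti-mono-≤ (fromℕ-mono-≤ (s≤s n≤m))
  fromℤ-mono-≤ (ℤ.-≤+ {m} {n})     =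
    ≤-trans (≤-respʳ-≈ -0#≈0# (-‿anti-mono-≤ (0≤fromℕ (suc m)))) (0≤fromℕ n)
  fromℤ-mono-≤ (ℤ.+≤+ m≤n)         = fromℕ-mono-≤ m≤n

  abstract
    floorℤ : ∀ x → ∃ λ i → fromℤ i ≤ x × x ≤ fromℤ (ℤ.suc i)
    floorℤ x =
      let k , -x<k = archimedean (- x)
          κ = fromℕ k
          0≤x+k : 0# ≤ x + κ
          0≤x+k = certify (x≤y⇒0≤y-x (<⇒≤ -x<k)) (solve 2 (λ x k → k :- :- x := x :+ k :- con (+ 0)) refl x κ)
          n , n≤x+k , x+k<1+n = floor 0≤x+k
          ν = fromℕ n
      in n ℤ.⊖ k
       , ≤-respˡ-≈ (sym (fromℤ-homo-⊖ n k)) (certify (x≤y⇒0≤y-x n≤x+k)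
           (solve 3 (λ x k n → x :+ k :- n := x :- (n :- k)) refl x κ ν))
       , ≤-respʳ-≈ (sym (trans (fromℤ-homo-+ (+ 1) (n ℤ.⊖ k)) (+-cong fromℕ-1 (fromℤ-homo-⊖ n k))))
           (certify (x≤y⇒0≤y-x (<⇒≤ x+k<1+n))
             (solve 3 (λ x k n → con (+ 1) :+ n :- (x :+ k) := con (+ 1) :+ (n :- k) :- x) refl x κ ν))

  nearest-endpoint : ∀ x i → fromℤ i ≤ x → x ≤ fromℤ (ℤ.suc i) →
    ∃ λ z → ∀ z′ → ∣ x - fromℤ z ∣ ≤ ∣ x - fromℤ z′ ∣
  nearest-endpoint x i i≤x x≤1+i = choose (total (x - lo) (hi - x))
    where
    lo = fromℤ i
    hi = fromℤ (ℤ.suc i)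

    0≤x-lo : 0# ≤ x - lo
    0≤x-lo = x≤y⇒0≤y-x i≤x
    0≤hi-x : 0# ≤ hi - x
    0≤hi-x = x≤y⇒0≤y-x x≤1+i

    lower : ∀ z → fromℤ z ≤ lo → x - lo ≤ ∣ x - fromℤ z ∣
    lower z z≤lo = ≤-trans (+-monoʳ-≤ x _ _ (-‿anti-mono-≤ z≤lo)) (x≤∣x∣ _)
    upper : ∀ z → hi ≤ fromℤ z → hi - x ≤ ∣ x - fromℤ z ∣
    upper z hi≤z = ≤-trans
      (≤-respʳ-≈ (solve 2 (λ x z → z :- x := :- (x :- z)) refl x (fromℤ z)) (+-monoˡ-≤ (- x) hi≤z))
      (-x≤∣x∣ _)
    split : ∀ z → fromℤ z ≤ lo ⊎ hi ≤ fromℤ z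
    split z with z ℤ.≤? i
    ... | yes z≤i = inj₁ (fromℤ-mono-≤ z≤i)
    ... | no  z≰i = inj₂ (fromℤ-mono-≤ (ℤ.i<j⇒suc[i]≤j (ℤ.≰⇒> z≰i)))

    ∣x-lo∣≤ : ∣ x - lo ∣ ≤ x - lo
    ∣x-lo∣≤ = ∣x∣≤y ≤-refl (≤-trans (≤-respʳ-≈ -0#≈0# (-‿anti-mono-≤ 0≤x-lo)) 0≤x-lo)
    ∣x-hi∣≤ : ∣ x - hi ∣ ≤ hi - x
    ∣x-hi∣≤ = ∣x∣≤y
      (≤-trans (≤-cong (solve 2 (λ x y → :- (y :- x) := x :- y) refl x hi) -0#≈0# (-‿anti-mono-≤ 0≤hi-x)) 0≤hi-x)
      (≤-reflexive (solve 2 (λ x y → :- (x :- y) := y :- x) refl x hi))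

    choose : x - lo ≤ hi - x ⊎ hi - x ≤ x - lo →
             ∃ λ z → ∀ z′ → ∣ x - fromℤ z ∣ ≤ ∣ x - fromℤ z′ ∣
    choose (inj₁ p) = i , λ z →
      ≤-trans ∣x-lo∣≤ ([ lower z , ≤-trans p ∘ upper z ]′ (split z))
    choose (inj₂ p) = ℤ.suc i , λ z →
      ≤-trans ∣x-hi∣≤ ([ ≤-trans p ∘ lower z , upper z ]′ (split z))

  abstract
    nearest-integer : ∀ x → ∃ λ z → ∀ z′ → ∣ x - fromℤ z ∣ ≤ ∣ x - fromℤ z′ ∣
    nearest-integer x = let i , i≤x , x≤1+i = floorℤ x in nearest-endpoint x i i≤x x≤1+i

    ‖‖-attained : ∀ x → ∃ λ z → ‖ x ‖ ≈ ∣ x - fromℤ z ∣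
    ‖‖-attained x = let z , least = nearest-integer x in
      proj₁ (minimum-spec (λ z → ∣ x - fromℤ z ∣) z least)

  -- The multiplicity of g in q and p is cancelled to reach the reduced fraction.
  irrational⇒q*θ≉p : ∀ {θ} → Irrational θ → ∀ q p → 1 ℕ.≤ q → ¬ (fromℕ q * θ ≈ fromℤ p)
  irrational⇒q*θ≉p {θ} irr q@(suc _) p _ qθ≈p = irr (p ℚ./ q , *-cancelˡ-≈ (0<⇒≉0 0<g) (begin-equality
    fromℤ g * (fromℤ (↧ r) * θ)       ≈⟨ *-assoc _ _ _ ⟨
    fromℤ g * fromℤ (↧ r) * θ         ≈⟨ *-congʳ (trans (*-comm _ _) (sym (fromℤ-homo-* (↧ r) g))) ⟩
    fromℤ (↧ r ℤ.* g) * θ             ≡⟨ ≡.cong (λ i → fromℤ i * θ) (ℚ.↧-/ p q) ⟩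
    fromℕ q * θ                       ≈⟨ qθ≈p ⟩
    fromℤ p                           ≡⟨ ≡.cong fromℤ (ℚ.↥-/ p q) ⟨
    fromℤ (↥ r ℤ.* g)                 ≈⟨ trans (fromℤ-homo-* (↥ r) g) (*-comm _ _) ⟩
    fromℤ g * fromℤ (↥ r)             ∎))
    where
    r = p ℚ./ q
    g = ℤ.gcd p (+ q)
    0<g : 0# < fromℤ g
    0<g = 0<fromℕ (ℕ.n≢0⇒n>0 (ℕ.gcd[m,n]≢0 ℤ.∣ p ∣ q (inj₂ λ ())))

  finite-minimum : (f : ℕ → ℝ) → ∀ n →
    ∃ λ q → (1 ℕ.≤ q × q ℕ.≤ suc n) × (∀ q′ → 1 ℕ.≤ q′ → q′ ℕ.≤ suc n → f q ≤ f q′)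
  finite-minimum f zero    = 1 , (s≤s z≤n , s≤s z≤n) , λ q′ 1≤q′ q′≤1 →
    ≤-reflexive (reflexive (≡.cong f (ℕ.≤-antisym 1≤q′ q′≤1)))
  finite-minimum f (suc n) with finite-minimum f n
  ... | q , (1≤q , q≤1+n) , least with total (f q) (f (suc (suc n)))
  ...   | inj₁ fq≤ = q , (1≤q , ℕ.m≤n⇒m≤1+n q≤1+n) , λ q′ 1≤q′ q′≤2+n →
    case ℕ.m≤n⇒m<n∨m≡n q′≤2+n of λ where
      (inj₁ q′<2+n)   → least q′ 1≤q′ (ℕ.≤-pred q′<2+n)
      (inj₂ ≡.refl) → fq≤
  ...   | inj₂ ≤fq = suc (suc n) , (s≤s z≤n , ℕ.≤-refl) , λ q′ 1≤q′ q′≤2+n →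
    case ℕ.m≤n⇒m<n∨m≡n q′≤2+n of λ where
      (inj₁ q′<2+n)   → ≤-trans ≤fq (least q′ 1≤q′ (ℕ.≤-pred q′<2+n))
      (inj₂ ≡.refl) → ≤-refl

  prefix-minimum : (ℕ → ℝ) → ℝ → ℝ
  prefix-minimum f t = minimum {I = ℤ₊≤ t} λ (q , _) → f q

  abstract
    prefix-minimum-spec : (f : ℕ → ℝ) → ∀ {n} → 1 ℕ.≤ n →
      (∃ λ q → (1 ℕ.≤ q × q ℕ.≤ n) × prefix-minimum f (fromℕ n) ≈ f q) ×
      (∀ q → 1 ℕ.≤ q → q ℕ.≤ n → prefix-minimum f (fromℕ n) ≤ f q)
    prefix-minimum-spec f {suc n} _ =
      let q , (1≤q , q≤1+n) , least = finite-minimum f n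
          (((q′ , 1≤q′ , q′≤n) , eq) , lower) =
            minimum-spec {I = ℤ₊≤ (fromℕ (suc n))} (λ (q , _) → f q) (q , 1≤q , fromℕ-mono-≤ q≤1+n)
              (λ (q′ , 1≤q′ , q′≤n) → least q′ 1≤q′ (fromℕ-cancel-≤ {q′} {suc n} q′≤n))
      in (q′ , (1≤q′ , fromℕ-cancel-≤ {q′} {suc n} q′≤n) , eq) ,
         λ q 1≤q q≤n → lower (q , 1≤q , fromℕ-mono-≤ q≤n)

  dist : ℝ → ℕ → ℝ
  dist α q = ‖ fromℕ q * α ‖

  quality : ℝ → ℕ → ℝ
  quality α q = fromℕ q * dist α q

  abstract
    0≤dist : ∀ α q → 0# ≤ dist α q
    0≤dist α q = let z , eq = ‖‖-attained (fromℕ q * α) in ≤-respʳ-≈ (sym eq) (0≤∣x∣ _)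

    dist-pos : ∀ {α} → Irrational α → ∀ q → 1 ℕ.≤ q → 0# < dist α q
    dist-pos {α} irr q 1≤q = 0≤dist α q , λ 0≈ →
      let z , eq = ‖‖-attained (fromℕ q * α)
      in irrational⇒q*θ≉p irr q z 1≤q (x-y≈0⇒x≈y (∣x∣≈0⇒x≈0 (sym (trans 0≈ eq))))

    quality-repulsion : ∀ α q q′ → 1 ℕ.≤ q → q ℕ.≤ q′ →
      quality α q′ < quality α q → fromℕ 2 * quality α q′ ≤ 1# →
      fromℕ q ≤ fromℕ 2 * quality α q * fromℕ q′
    quality-repulsion α q q′ 1≤q q≤q′ smaller small =
      let z  , eq  = ‖‖-attained (fromℕ q * α)
          z′ , eq′ = ‖‖-attained (fromℕ q′ * α)
          1≤2q′e : 1# ≤ fromℕ 2 * (fromℕ q′ * ∣ error α q z ∣)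
          1≤2q′e = repulsion α q z q′ z′ 1≤q q≤q′ (<-cong (*-congˡ eq′) (*-congˡ eq) smaller)
                     (≤-respˡ-≈ (*-congˡ (*-congˡ eq′)) small)
      in begin
      fromℕ q                                                ≤⟨ x≤x*y (0≤fromℕ q) 1≤2q′e ⟩
      fromℕ q * (fromℕ 2 * (fromℕ q′ * ∣ error α q z ∣))     ≈⟨ *-congˡ (*-congˡ (*-congˡ eq)) ⟨
      fromℕ q * (fromℕ 2 * (fromℕ q′ * dist α q))
        ≈⟨ solve 4 (λ t q q′ e → q :* (t :* (q′ :* e)) := t :* (q :* e) :* q′)
             refl (fromℕ 2) (fromℕ q) (fromℕ q′) (dist α q) ⟩
      fromℕ 2 * quality α q * fromℕ q′                       ∎

  pigeonhole : ∀ (a b c : Bool) → a ≡ b ⊎ a ≡ c ⊎ b ≡ c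
  pigeonhole false false _     = inj₁ ≡.refl
  pigeonhole true  true  _     = inj₁ ≡.refl
  pigeonhole false true  false = inj₂ (inj₁ ≡.refl)
  pigeonhole true  false true  = inj₂ (inj₁ ≡.refl)
  pigeonhole false true  true  = inj₂ (inj₂ ≡.refl)
  pigeonhole true  false false = inj₂ (inj₂ ≡.refl)

  module Records
    (α : Bool → ℝ) (m : ℕ → ℝ)
    (attained : ∀ n → 1 ℕ.≤ n → ∃ λ b → ∃ λ q → (1 ℕ.≤ q × q ℕ.≤ n) × m n ≈ quality (α b) q)
    (lower    : ∀ n b q → 1 ℕ.≤ q → q ℕ.≤ n → m n ≤ quality (α b) q)
    (positive : ∀ n → 1 ℕ.≤ n → 0# < m n)
    {A B N : ℕ} (1≤A : 1 ℕ.≤ A) (1≤N : 1 ℕ.≤ N)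
    {C : ℝ} (0≤C : 0# ≤ C) (T : ℕ)
    (m-upper : ∀ n → T ℕ.≤ n → m n ^ N * fromℕ n ^ A ≤ C)
    (quality-lower : ∀ b q → T ℕ.≤ q → 1# ≤ quality (α b) q ^ N * fromℕ q ^ B)
    where

    record Record : Set where
      field
        pred-Q : ℕ
        colour : Bool
      Q : ℕ
      Q = suc pred-Q
      v : ℝ
      v = m Q
      field
        v≈quality : v ≈ quality (α colour) Q
      1≤Q : 1 ℕ.≤ Q
      1≤Q = s≤s z≤n
      0<v : 0# < v
      0<v = positive Q 1≤Q

    open Record

    abstract
      m-vanishes : ∀ {ε} → 0# < ε → ∃ λ K → T ℕ.≤ K × (∀ k → K ℕ.≤ k → m k < ε)
      m-vanishes {ε} 0<ε =
        let z , ε^Nz≈C = divide C (^-pos N 0<ε)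
            n , z<n    = archimedean z
            K          = n ℕ.⊔ (T ℕ.⊔ 1)
            bound : ∀ k → K ℕ.≤ k → m k < ε
            bound k K≤k =
              let T⊔1≤k = ℕ.≤-trans (ℕ.m≤n⊔m n (T ℕ.⊔ 1)) K≤k
                  1≤k = ℕ.≤-trans (ℕ.m≤n⊔m T 1) T⊔1≤k
                  T≤k = ℕ.≤-trans (ℕ.m≤m⊔n T 1) T⊔1≤k
                  n≤k = ℕ.≤-trans (ℕ.m≤m⊔n n (T ℕ.⊔ 1)) K≤k
              in ≰⇒> λ ε≤mk → <⇒≱ (begin-strict
                C                       ≈⟨ ε^Nz≈C ⟨
                ε ^ N * z               <⟨ *-monoˡ-< (^-pos N 0<ε) z<n ⟩
                ε ^ N * fromℕ n
                  ≤⟨ *-mono-≤ (^-nonNeg N (<⇒≤ 0<ε)) (0≤fromℕ n) (^-monoˡ-≤ N (<⇒≤ 0<ε) ε≤mk) (fromℕ-mono-≤ n≤k) ⟩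
                m k ^ N * fromℕ k
                  ≤⟨ *-monoˡ-≤ (^-nonNeg N (<⇒≤ (positive k 1≤k))) (x≤x^n (1≤fromℕ 1≤k) 1≤A) ⟩
                m k ^ N * fromℕ k ^ A   ∎) (m-upper k T≤k)
        in K , ℕ.≤-trans (ℕ.m≤m⊔n T 1) (ℕ.m≤n⊔m n (T ℕ.⊔ 1)) , bound

      next-record : ∀ n → 1 ℕ.≤ n → ∃ λ r → n ℕ.≤ pred-Q r × m n ≤ m (pred-Q r) × v r < m n
      next-record n 1≤n =
        let K , _ , mk<mn = m-vanishes (positive n 1≤n)
            j , ≮mn , <mn = transition (λ j → m (j ℕ.+ n) < m n) (λ p → <⇒≱ p ≤-refl) K
                              (mk<mn (K ℕ.+ n) (ℕ.m≤m+n K n))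
            k   = j ℕ.+ n
            n≤k = ℕ.m≤n+m n j
            b , q , (1≤q , q≤1+k) , eq = attained (suc k) (s≤s z≤n)
            q≡1+k : q ≡ suc k
            q≡1+k = case ℕ.m≤n⇒m<n∨m≡n q≤1+k of λ where
              (inj₁ q<1+k) → ⊥-elim (≮mn (≤-<-trans (lower k b q 1≤q (ℕ.≤-pred q<1+k)) (<-respˡ-≈ eq <mn)))
              (inj₂ q≡1+k) → q≡1+k
        in record { pred-Q = k ; colour = b ; v≈quality = ≡.subst (λ q → m (suc k) ≈ quality (α b) q) q≡1+k eq }
         , n≤k , ≮⇒≥ ≮mn , <mn

      record-repulsion : ∀ r s → colour r ≡ colour s → Q r ℕ.≤ Q s → v s < v r → fromℕ 2 * v s ≤ 1# →
        fromℕ (Q r) ≤ fromℕ 2 * v r * fromℕ (Q s)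
      record-repulsion r s same Qr≤Qs vs<vr 2vs≤1 = ≤-respʳ-≈ (*-congʳ (*-congˡ (sym (v≈quality r))))
        (quality-repulsion (α (colour r)) (Q r) (Q s) (1≤Q r) Qr≤Qs (<-cong eq (v≈quality r) vs<vr)
          (≤-respˡ-≈ (*-congˡ eq) 2vs≤1))
        where
        eq : v s ≈ quality (α (colour r)) (Q s)
        eq = ≡.subst (λ b → v s ≈ quality (α b) (Q s)) (≡.sym same) (v≈quality s)

      -- Q ≤ 2(Q − 1) turns the bound at Q − 1 into a bound at Q.
      m-upper′ : ∀ n k → 1 ℕ.≤ k → T ℕ.≤ k → 0# ≤ m n → m n ≤ m k →
        m n ^ N * fromℕ (suc k) ^ A ≤ fromℕ 2 ^ A * C
      m-upper′ n k 1≤k T≤k 0≤mn mn≤mk = begin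
        m n ^ N * fromℕ (suc k) ^ A
          ≤⟨ *-mono-≤ (^-nonNeg N 0≤mn) (^-nonNeg A (0≤fromℕ (suc k))) (^-monoˡ-≤ N 0≤mn mn≤mk) (^-monoˡ-≤ A (0≤fromℕ (suc k)) 1+k≤2k) ⟩
        m k ^ N * (fromℕ 2 * fromℕ k) ^ A         ≈⟨ *-congˡ (^-distrib-* (fromℕ 2) (fromℕ k) A) ⟩
        m k ^ N * (fromℕ 2 ^ A * fromℕ k ^ A)
          ≈⟨ solve 3 (λ u t w → u :* (t :* w) := t :* (u :* w))
               refl (m k ^ N) (fromℕ 2 ^ A) (fromℕ k ^ A) ⟩
        fromℕ 2 ^ A * (m k ^ N * fromℕ k ^ A)     ≤⟨ *-monoˡ-≤ (^-nonNeg A (0≤fromℕ 2)) (m-upper k T≤k) ⟩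
        fromℕ 2 ^ A * C                           ∎
        where
        1+k≤2k : 1# + fromℕ k ≤ fromℕ 2 * fromℕ k
        1+k≤2k = ≤-respʳ-≈ (x+x≈2x (fromℕ k)) (+-monoˡ-≤ (fromℕ k) (1≤fromℕ 1≤k))

      large-triple : ∀ n → 1 ℕ.≤ n → T ℕ.≤ n → (∀ k → n ℕ.≤ k → fromℕ 2 * m k ≤ 1#) →
        ∃ λ x → ∃ λ y → ∃ λ z → ∃ λ v₀ → ∃ λ v₁ → fromℕ n < x ×
          Triple {A} {B} {N} 1≤A 1≤N {fromℕ 2 ^ A * C} (*-nonNeg _ _ (^-nonNeg A (0≤fromℕ 2)) 0≤C) x y z v₀ v₁
      large-triple n 1≤n T≤n small =
        let r₀ , n≤ , _ , _             = next-record n 1≤n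
            r₁ , Q₀≤ , v₀≤ , v₁<v₀    = next-record (Q r₀) (1≤Q r₀)
            r₂ , Q₁≤ , v₁≤ , v₂<v₁    = next-record (Q r₁) (1≤Q r₁)
            n≤Q₀ = ℕ.m≤n⇒m≤1+n n≤
            n≤p₁ = ℕ.≤-trans n≤Q₀ Q₀≤
            n≤Q₁ = ℕ.m≤n⇒m≤1+n n≤p₁
            n≤p₂ = ℕ.≤-trans n≤Q₁ Q₁≤
            n≤Q₂ = ℕ.m≤n⇒m≤1+n n≤p₂
            Q₀≤Q₁ = ℕ.m≤n⇒m≤1+n Q₀≤
            Q₁≤Q₂ = ℕ.m≤n⇒m≤1+n Q₁≤
            F : Record → ℝ
            F r = fromℕ (Q r)
            0≤2v : ∀ r → 0# ≤ fromℕ 2 * v r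
            0≤2v r = *-nonNeg _ _ (0≤fromℕ 2) (<⇒≤ (0<v r))
            quality-bound : ∀ r → n ℕ.≤ Q r → 1# ≤ v r ^ N * fromℕ (Q r) ^ B
            quality-bound r n≤Q = ≤-respʳ-≈ (*-congʳ (^-congˡ N (sym (v≈quality r))))
              (quality-lower (colour r) (Q r) (ℕ.≤-trans T≤n n≤Q))
            repelled : F r₀ ≤ fromℕ 2 * v r₀ * F r₂
            repelled = case pigeonhole (colour r₀) (colour r₁) (colour r₂) of λ where
              (inj₁ same) → ≤-trans (record-repulsion r₀ r₁ same Q₀≤Q₁ v₁<v₀ (small (Q r₁) n≤Q₁))
                (*-monoˡ-≤ (0≤2v r₀) (fromℕ-mono-≤ Q₁≤Q₂))
              (inj₂ (inj₁ same)) → record-repulsion r₀ r₂ same (ℕ.≤-trans Q₀≤Q₁ Q₁≤Q₂)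
                (<-trans v₂<v₁ v₁<v₀) (small (Q r₂) n≤Q₂)
              (inj₂ (inj₂ same)) → ≤-trans (fromℕ-mono-≤ Q₀≤Q₁)
                (≤-trans (record-repulsion r₁ r₂ same Q₁≤Q₂ v₂<v₁ (small (Q r₂) n≤Q₂))
                  (*-monoʳ-≤ (0≤fromℕ (Q r₂)) (*-monoˡ-≤ (0≤fromℕ 2) (<⇒≤ v₁<v₀))))
        in F r₀ , F r₁ , F r₂ , v r₀ , v r₁ , fromℕ-mono-< (s≤s n≤) , record
          { 1≤x    = 1≤fromℕ (1≤Q r₀)
          ; 1≤y    = 1≤fromℕ (1≤Q r₁)
          ; 1≤z    = 1≤fromℕ (1≤Q r₂)
          ; 0≤v₀   = <⇒≤ (0<v r₀)
          ; v₀y≤C  = m-upper′ (Q r₀) (pred-Q r₁) (ℕ.≤-trans (1≤Q r₀) Q₀≤) (ℕ.≤-trans T≤n n≤p₁) (<⇒≤ (0<v r₀)) v₀≤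
          ; v₁z≤C  = m-upper′ (Q r₁) (pred-Q r₂) (ℕ.≤-trans (1≤Q r₁) Q₁≤) (ℕ.≤-trans T≤n n≤p₂) (<⇒≤ (0<v r₁)) v₁≤
          ; 1≤v₀x  = quality-bound r₀ n≤Q₀
          ; 1≤v₁y  = quality-bound r₁ n≤Q₁
          ; x≤2v₀z = repelled
          }

      exponents-incompatible : ¬ (B ℕ.* B ℕ.* N ℕ.< A ℕ.* A ℕ.* (B ℕ.+ N))
      exponents-incompatible ineq =
        let ½ , 2½≈1 = divide 1# (0<fromℕ {2} (s≤s z≤n))
            0<½ : 0# < ½
            0<½ = *-cancelˡ-< (0≤fromℕ 2) (<-cong (sym (zeroʳ _)) (sym 2½≈1) 0<1)
            K₁ , T≤K₁ , m<½ = m-vanishes 0<½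
            K , bounded = triples-bounded {A} {B} {N} 1≤A 1≤N {fromℕ 2 ^ A * C} (*-nonNeg _ _ (^-nonNeg A (0≤fromℕ 2)) 0≤C) ineq
            K₂ , K<K₂ = archimedean K
            n = K₁ ℕ.⊔ (K₂ ℕ.⊔ 1)
            K₁≤n = ℕ.m≤m⊔n K₁ (K₂ ℕ.⊔ 1)
            K₂⊔1≤n = ℕ.m≤n⊔m K₁ (K₂ ℕ.⊔ 1)
            x , y , z , v₀ , v₁ , n<x , triple = large-triple n (ℕ.≤-trans (ℕ.m≤n⊔m K₂ 1) K₂⊔1≤n) (ℕ.≤-trans T≤K₁ K₁≤n)
              λ k n≤k → ≤-respʳ-≈ 2½≈1 (*-monoˡ-≤ (0≤fromℕ 2) (<⇒≤ (m<½ k (ℕ.≤-trans K₁≤n n≤k))))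
        in <⇒≱ K<K₂ (≤-trans (fromℕ-mono-≤ (ℕ.≤-trans (ℕ.m≤m⊔n K₂ 1) K₂⊔1≤n)) (≤-trans (<⇒≤ n<x) (bounded triple)))

  -- Real powers, suprema and infima

  the-elim : {A : Set} {d : A} {P : A → Set} (Q : A → Set) → (∀ x → P x → Q x) → Q d → Q (the d P)
  the-elim {P = P} Q q qd with lem {P = ∃ P}
  ... | yes (x , px) = q x px
  ... | no _         = qd

  rational-power-≤ : ∀ {t γ s} {M N : ℕ} → 1# ≤ t → 1 ℕ.≤ N → fromℕ N * γ ≤ fromℕ M → 0# ≤ s → s ^ N ≈ t ^ M →
    ∀ r {s′} → r ≤ℚ γ → IsRationalPower t r s′ → s′ ≤ s
  rational-power-≤ {t} {γ} {s} {M} {N} 1≤t 1≤N Nγ≤M 0≤s s^N≈t^M (mkℚ (+ p) k-1 _) {s′} p≤kγ (0≤s′ , s′^k≈t^p) =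
    ^-cancel-≤ (ℕ.*-mono-≤ 1≤N (s≤s (z≤n {k-1}))) 0≤s (begin
      s′ ^ (N ℕ.* k)      ≡⟨ ≡.cong (s′ ^_) (ℕ.*-comm N k) ⟩
      s′ ^ (k ℕ.* N)      ≈⟨ ^-assocʳ s′ k N ⟨
      (s′ ^ k) ^ N        ≈⟨ ^-congˡ N s′^k≈t^p ⟩
      (t ^ p) ^ N         ≈⟨ ^-assocʳ t p N ⟩
      t ^ (p ℕ.* N)       ≤⟨ ^-monoʳ-≤ 1≤t pN≤Mk ⟩
      t ^ (M ℕ.* k)       ≈⟨ ^-assocʳ t M k ⟨
      (t ^ M) ^ k         ≈⟨ ^-congˡ k s^N≈t^M ⟨
      (s ^ N) ^ k         ≈⟨ ^-assocʳ s N k ⟩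
      s ^ (N ℕ.* k)       ∎)
    where
    k = suc k-1
    pN≤Mk : p ℕ.* N ℕ.≤ M ℕ.* k
    pN≤Mk = fromℕ-cancel-≤ {p ℕ.* N} {M ℕ.* k} (begin
      fromℕ (p ℕ.* N)              ≈⟨ fromℕ-homo-* p N ⟩
      fromℕ p * fromℕ N            ≤⟨ *-monoʳ-≤ (0≤fromℕ N) p≤kγ ⟩
      fromℕ k * γ * fromℕ N
        ≈⟨ solve 3 (λ k γ n → k :* γ :* n := n :* γ :* k) refl (fromℕ k) γ (fromℕ N) ⟩
      fromℕ N * γ * fromℕ k        ≤⟨ *-monoʳ-≤ (0≤fromℕ k) Nγ≤M ⟩
      fromℕ M * fromℕ k            ≈⟨ fromℕ-homo-* M k ⟨
      fromℕ (M ℕ.* k)              ∎)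
  rational-power-≤ {t} {γ} {s} {M} {N} 1≤t 1≤N Nγ≤M 0≤s s^N≈t^M (mkℚ -[1+ p ] k-1 _) {s′} _ (0≤s′ , s′^k*t≈1) =
    ≤-trans s′≤1 1≤s
    where
    k = suc k-1
    s′≤1 : s′ ≤ 1#
    s′≤1 = ^-cancel-≤ {n = k} (s≤s z≤n) 0≤1 (begin
      s′ ^ k                  ≤⟨ x≤x*y (^-nonNeg k 0≤s′) (1≤^ (suc p) 1≤t) ⟩
      s′ ^ k * t ^ suc p      ≈⟨ s′^k*t≈1 ⟩
      1#                      ≈⟨ 1^n≈1 k ⟨
      1# ^ k                  ∎)
    1≤s : 1# ≤ s
    1≤s = ^-cancel-≤ 1≤N 0≤s (≤-cong (sym (1^n≈1 N)) (sym s^N≈t^M) (1≤^ M 1≤t))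

  abstract
    ^ᴿ-≤-root : ∀ {t γ s} {M N : ℕ} → 1# ≤ t → 1 ℕ.≤ N → fromℕ N * γ ≤ fromℕ M →
      0# ≤ s → s ^ N ≈ t ^ M → t ^ᴿ γ ≤ s
    ^ᴿ-≤-root {s = s} {M} {N} 1≤t 1≤N Nγ≤M 0≤s s^N≈t^M = the-elim (_≤ s)
      (λ x (_ , least) → least s λ (s′ , r , r≤γ , pow) →
        rational-power-≤ {M = M} {N} 1≤t 1≤N Nγ≤M 0≤s s^N≈t^M r r≤γ pow)
      0≤s

    rational-power-≤-^ᴿ : ∀ {t γ} r {s} → 1# ≤ t → r ≤ℚ γ → IsRationalPower t r s → s ≤ t ^ᴿ γ
    rational-power-≤-^ᴿ {t} {γ} r {s} 1≤t r≤γ pow =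
      let M , γ<M = archimedean γ
          s₀ , 0≤s₀ , s₀^1≈t^M = root {1} {t ^ M} (s≤s z≤n) (^-nonNeg M (1≤⇒0≤ 1≤t))
          1γ≤M : fromℕ 1 * γ ≤ fromℕ M
          1γ≤M = ≤-respˡ-≈ (trans (sym (*-identityˡ γ)) (*-congʳ (sym fromℕ-1))) (<⇒≤ γ<M)
          ub , _ = the-spec {P = Bounds.IsSupremum _≤_ powers} (complete powers (s , r , r≤γ , pow)
            (s₀ , λ (s′ , r′ , r′≤γ , pow′) → rational-power-≤ {M = M} {1} 1≤t (s≤s z≤n) 1γ≤M 0≤s₀ s₀^1≈t^M r′ r′≤γ pow′))
      in ub (s , r , r≤γ , pow)
      where
      powers : (∃ λ s → ∃ λ r → r ≤ℚ γ × IsRationalPower t r s) → ℝ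
      powers = proj₁

    unreduced-power : ∀ {t γ} r g {M N : ℕ} → ↥ r ℤ.* + g ≡ + M → ↧ r ℤ.* + g ≡ + N → 1 ℕ.≤ N →
      1# ≤ t → fromℕ M ≤ fromℕ N * γ → ∃ λ s → 0# ≤ s × s ^ N ≈ t ^ M × s ≤ t ^ᴿ γ
    unreduced-power r zero eqM eqN 1≤N 1≤t M≤Nγ =
      ⊥-elim (ℕ.<⇒≢ 1≤N (ℤ.+-injective (≡.trans (≡.sym (ℤ.*-zeroʳ (↧ r))) eqN)))
    unreduced-power (mkℚ -[1+ _ ] _ _) (suc g) () _ _ _ _
    unreduced-power {t} {γ} r@(mkℚ (+ p) k-1 _) g@(suc _) {M} {N} eqM eqN _ 1≤t M≤Nγ =
      let k = suc k-1
          M≡pg : M ≡ p ℕ.* g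
          M≡pg = ℤ.+-injective (≡.trans (≡.sym eqM) (≡.sym (ℤ.pos-* p g)))
          N≡kg : N ≡ k ℕ.* g
          N≡kg = ℤ.+-injective (≡.trans (≡.sym eqN) (≡.sym (ℤ.pos-* k g)))
          s , 0≤s , s^k≈t^p = root {k} {t ^ p} (s≤s z≤n) (^-nonNeg p (1≤⇒0≤ 1≤t))
          p≤kγ : fromℕ p ≤ fromℕ k * γ
          p≤kγ = *-cancelʳ-≤ {z = fromℕ g} (0<fromℕ {g} (s≤s z≤n)) (begin
            fromℕ p * fromℕ g         ≈⟨ fromℕ-homo-* p g ⟨
            fromℕ (p ℕ.* g)           ≡⟨ ≡.cong fromℕ M≡pg ⟨
            fromℕ M                   ≤⟨ M≤Nγ ⟩
            fromℕ N * γ               ≡⟨ ≡.cong (λ n → fromℕ n * γ) N≡kg ⟩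
            fromℕ (k ℕ.* g) * γ       ≈⟨ *-congʳ (fromℕ-homo-* k g) ⟩
            fromℕ k * fromℕ g * γ
              ≈⟨ solve 3 (λ k g γ → k :* g :* γ := k :* γ :* g) refl (fromℕ k) (fromℕ g) γ ⟩
            fromℕ k * γ * fromℕ g     ∎)
      in s , 0≤s , (begin-equality
        s ^ N             ≡⟨ ≡.cong (s ^_) N≡kg ⟩
        s ^ (k ℕ.* g)     ≈⟨ ^-assocʳ s k g ⟨
        (s ^ k) ^ g       ≈⟨ ^-congˡ g s^k≈t^p ⟩
        (t ^ p) ^ g       ≈⟨ ^-assocʳ t p g ⟩
        t ^ (p ℕ.* g)     ≡⟨ ≡.cong (t ^_) M≡pg ⟨
        t ^ M             ∎) , rational-power-≤-^ᴿ r 1≤t p≤kγ (0≤s , s^k≈t^p)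

    root-≤-^ᴿ : ∀ {t γ} {M N : ℕ} → 1# ≤ t → 1 ℕ.≤ N → fromℕ M ≤ fromℕ N * γ →
      ∃ λ s → 0# ≤ s × s ^ N ≈ t ^ M × s ≤ t ^ᴿ γ
    root-≤-^ᴿ {M = M} {N@(suc _)} 1≤t 1≤N =
      unreduced-power (ℚ.normalize M N) (ℕ.gcd M N) (ℚ.↥-normalize M N) (ℚ.↧-normalize M N) 1≤N 1≤t

    ^ᴿ-nonNeg : ∀ {t γ} → 1# ≤ t → 0# ≤ γ → 0# ≤ t ^ᴿ γ
    ^ᴿ-nonNeg {t} {γ} 1≤t 0≤γ =
      let s , 0≤s , _ , s≤ = root-≤-^ᴿ {t} {γ} {0} {1} 1≤t (s≤s z≤n)
            (≤-respʳ-≈ (trans (sym (*-identityˡ γ)) (*-congʳ (sym fromℕ-1))) 0≤γ)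
      in ≤-trans 0≤s s≤

  ≤±-trans : ∀ {x y z} → x ≤± y → y ≤± z → x ≤± z
  ≤±-trans = TotalOrder.trans ℝ±-totalOrder

  ⨆-spec : {I : Set} (f : I → ℝ) → Bounds.IsSupremum _≤±_ (λ i → [ f i ]) (⨆ λ i → [ f i ])
  ⨆-spec {I} f = the-spec {P = Bounds.IsSupremum _≤±_ (λ i → [ f i ])} exists
    where
    exists : ∃ (Bounds.IsSupremum _≤±_ (λ i → [ f i ]))
    exists with lem {P = I}
    ... | no ¬i = ⊥± , (λ i → ⊥-elim (¬i i)) , λ u _ → ⊥±≤ u
    ... | yes i with lem {P = ∃ (Bounds.IsUpperBound _≤_ f)}
    ...   | yes bounded =
      let s , ub , least = complete f i bounded
      in [ s ] , (λ i → [ ub i ]≤) , λ where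
        ⊥±     below → case below i of λ { (Sup.[ () ]) }
        [ u ]  below → [ least u (λ i → [≤]-injective (below i)) ]≤
        ⊤±     below → [ s ]≤⊤±
    ...   | no unbounded = ⊤± , (λ i → [ f i ]≤⊤±) , λ where
        ⊥±     below → case below i of λ { (Sup.[ () ]) }
        [ u ]  below → ⊥-elim (unbounded (u , λ i → [≤]-injective (below i)))
        ⊤±     below → ⊤±≤⊤±

  ⨅-spec : {I : Set} (f : I → ℝ) → I → ∃ (Bounds.IsLowerBound _≤_ f) →
    Bounds.IsInfimum _≤±_ (λ i → [ f i ]) (⨅ λ i → [ f i ])
  ⨅-spec {I} f i lower = the-spec {P = Bounds.IsInfimum _≤±_ (λ i → [ f i ])} exists
    where
    exists : ∃ (Bounds.IsInfimum _≤±_ (λ i → [ f i ]))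
    exists =
      let s , ub , least = complete {∃ (Bounds.IsLowerBound _≤_ f)} proj₁ lower (f i , λ (l , lb) → lb i)
      in [ s ] , (λ i → [ least (f i) (λ (l , lb) → lb i) ]≤) , λ where
        ⊥±    _     → ⊥±≤[ s ]
        [ l ] below → [ ub (l , λ i → [≤]-injective (below i)) ]≤
        ⊤±    above → case above i of λ ()

  abstract
    limsup<⊤⇒bounded : ∀ f → limsup f <± ⊤± → ∃ λ T → 1# ≤ T × ∃ λ b → ∀ t → T ≤ t → f t ≤ b
    limsup<⊤⇒bounded f limsup<⊤ with lem {P = ∃ λ T → 1# ≤ T × ∃ λ b → ∀ t → T ≤ t → f t ≤ b}
    ... | yes bounded   = bounded
    ... | no  unbounded = ⊥-elim (the-elim (λ x → ¬ (x <± ⊤±)) (λ x (_ , greatest) → ⊤≤⇒≮⊤ (greatest ⊤± ⊤≤tail)) (λ ()) limsup<⊤)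
      where
      tail : ∀ T → (∃ λ t → T ≤ t) → ℝ
      tail T (t , _) = f t
      ⊤≤⇒≮⊤ : ∀ {x} → ⊤± ≤± x → ¬ (x <± ⊤±)
      ⊤≤⇒≮⊤ ⊤±≤⊤± ()
      ⊤≤sup : ∀ T → 1# ≤ T → ∀ s → Bounds.IsUpperBound _≤±_ (λ i → [ tail T i ]) s → ⊤± ≤± s
      ⊤≤sup T 1≤T ⊥±    ub = case ub (T , ≤-refl) of λ { (Sup.[ () ]) }
      ⊤≤sup T 1≤T [ b ] ub = ⊥-elim (unbounded (T , 1≤T , b , λ t T≤t → [≤]-injective (ub (t , T≤t))))
      ⊤≤sup T 1≤T ⊤±    ub = ⊤±≤⊤±
      ⊤≤tail : ∀ ((T , _) : ∃ λ T → 1# ≤ T) → ⊤± ≤± ⨆ (λ i → [ tail T i ])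
      ⊤≤tail (T , 1≤T) = ⊤≤sup T 1≤T _ (proj₁ (⨆-spec (tail T)))

    liminf≮⊤⇒large : ∀ f → (∀ t → 1# ≤ t → 0# ≤ f t) → ¬ (liminf f <± ⊤±) →
      ∃ λ T → 1# ≤ T × (∀ t → T ≤ t → 1# ≤ f t)
    liminf≮⊤⇒large f 0≤f liminf≮⊤ with lem {P = ∃ λ T → 1# ≤ T × (∀ t → T ≤ t → 1# ≤ f t)}
    ... | yes large = large
    ... | no ¬large = ⊥-elim (liminf≮⊤ (the-elim (_<± ⊤±) (λ x (_ , least) → ≤1⇒<⊤ (least [ 1# ] tail≤1)) ⊥±<⊤±))
      where
      tail : ∀ T → (∃ λ t → T ≤ t) → ℝ
      tail T (t , _) = f t
      ≤1⇒<⊤ : ∀ {x} → x ≤± [ 1# ] → x <± ⊤±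
      ≤1⇒<⊤ {⊥±}    _ = ⊥±<⊤±
      ≤1⇒<⊤ {[ x ]} _ = [ x ]<⊤±
      ≤1⇒<⊤ {⊤±}    ()
      tail≤1 : ∀ ((T , _) : ∃ λ T → 1# ≤ T) → ⨅ (λ i → [ tail T i ]) ≤± [ 1# ]
      tail≤1 (T , 1≤T) =
        let (t , T≤t) , ft≱1 = ¬∀⇒∃¬ {P = λ i → 1# ≤ tail T i} (λ large → ¬large (T , 1≤T , λ t T≤t → large (t , T≤t)))
            lb , _ = ⨅-spec (tail T) (T , ≤-refl) (0# , λ (t , T≤t) → 0≤f t (≤-trans 1≤T T≤t))
        in ≤±-trans (lb (t , T≤t)) [ <⇒≤ (≰⇒> ft≱1) ]≤

  ψ-nonNeg : ∀ α t → 0# ≤ ψ α t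
  ψ-nonNeg α t = the-elim {P = λ x → (∃ λ i → x ≈ f i) × Bounds.IsLowerBound _≤_ f x} (0# ≤_)
    (λ _ (((q , _) , eq) , _) → ≤-respʳ-≈ (sym eq) (0≤dist α q)) ≤-refl
    where
    f : ℤ₊≤ t → ℝ
    f (q , _) = dist α q

  abstract
    ω<⇒quality-lower : ∀ α {x w} (B : ℕ) {N : ℕ} → ω α ≤± [ x ] → x < w → 0# ≤ w → 1 ℕ.≤ N →
      fromℕ N * w ≤ fromℕ (N ℕ.+ B) →
      ∃ λ T → ∀ q → T ℕ.≤ q → 1# ≤ quality α q ^ N * fromℕ q ^ B
    ω<⇒quality-lower α {x} {w} B {N} ω≤x x<w 0≤w 1≤N Nw≤N+B =
      let T , 1≤T , large = liminf≮⊤⇒large f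
            (λ t 1≤t → *-nonNeg _ _ (^ᴿ-nonNeg 1≤t 0≤w) (ψ-nonNeg α t))
            (λ finite → <⇒≱ x<w ([≤]-injective (≤±-trans (proj₁ (⨆-spec exponents) (w , finite)) ω≤x)))
          T′ , T<T′ = archimedean T
      in T′ , λ q T′≤q →
        let T≤q = ≤-trans (<⇒≤ T<T′) (fromℕ-mono-≤ T′≤q)
        in lower q (fromℕ-cancel-≤ {1} {q} (≤-respˡ-≈ (sym fromℕ-1) (≤-trans 1≤T T≤q))) (large (fromℕ q) T≤q)
      where
      f : ℝ → ℝ
      f t = t ^ᴿ w * ψ α t
      exponents : (∃ λ γ → liminf (λ t → t ^ᴿ γ * ψ α t) <± ⊤±) → ℝ
      exponents (γ , _) = γ
      lower : ∀ q → 1 ℕ.≤ q → 1# ≤ f (fromℕ q) → 1# ≤ quality α q ^ N * fromℕ q ^ B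
      lower q 1≤q 1≤f =
        let t = fromℕ q
            s , 0≤s , s^N≈ = root {N} {t ^ (N ℕ.+ B)} 1≤N (^-nonNeg (N ℕ.+ B) (0≤fromℕ q))
            ψ≤dist : ψ α t ≤ dist α q
            ψ≤dist = proj₂ (prefix-minimum-spec (dist α) 1≤q) q 1≤q ℕ.≤-refl
            1≤s*dist : 1# ≤ s * dist α q
            1≤s*dist = ≤-trans 1≤f (*-mono-≤ (^ᴿ-nonNeg (1≤fromℕ 1≤q) 0≤w) (ψ-nonNeg α t)
              (^ᴿ-≤-root {M = N ℕ.+ B} {N} (1≤fromℕ 1≤q) 1≤N Nw≤N+B 0≤s s^N≈) ψ≤dist)
        in begin
        1#                                ≤⟨ 1≤^ N 1≤s*dist ⟩
        (s * dist α q) ^ N                ≈⟨ ^-distrib-* s (dist α q) N ⟩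
        s ^ N * dist α q ^ N              ≈⟨ *-congʳ (trans s^N≈ (^-homo-* t N B)) ⟩
        t ^ N * t ^ B * dist α q ^ N
          ≈⟨ solve 3 (λ u v w → u :* v :* w := u :* w :* v) refl (t ^ N) (t ^ B) (dist α q ^ N) ⟩
        t ^ N * dist α q ^ N * t ^ B      ≈⟨ *-congʳ (^-distrib-* t (dist α q) N) ⟨
        quality α q ^ N * t ^ B           ∎

  module _ (θ η : ℝ) where

    number : Bool → ℝ
    number false = θ
    number true  = η

    υ₂ₙ : ℕ → ℝ
    υ₂ₙ n = υ₂ θ η (fromℕ n)

    υ-spec : ∀ α n → 1 ℕ.≤ n →
      (∃ λ q → (1 ℕ.≤ q × q ℕ.≤ n) × υ α (fromℕ n) ≈ quality α q) ×
      (∀ q → 1 ℕ.≤ q → q ℕ.≤ n → υ α (fromℕ n) ≤ quality α q)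
    υ-spec α n 1≤n = prefix-minimum-spec (quality α) 1≤n

    abstract
      υ₂-attained : ∀ n → 1 ℕ.≤ n →
        ∃ λ b → ∃ λ q → (1 ℕ.≤ q × q ℕ.≤ n) × υ₂ₙ n ≈ quality (number b) q
      υ₂-attained n 1≤n = case ⊓-sel (υ θ (fromℕ n)) (υ η (fromℕ n)) of λ where
        (inj₁ eq) → let q , q-range , eq′ = proj₁ (υ-spec θ n 1≤n) in false , q , q-range , trans eq eq′
        (inj₂ eq) → let q , q-range , eq′ = proj₁ (υ-spec η n 1≤n) in true , q , q-range , trans eq eq′

      υ₂-lower : ∀ n b q → 1 ℕ.≤ q → q ℕ.≤ n → υ₂ₙ n ≤ quality (number b) q
      υ₂-lower n false q 1≤q q≤n = ≤-trans (x⊓y≤x (υ θ (fromℕ n)) (υ η (fromℕ n)))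
        (proj₂ (υ-spec θ n (ℕ.≤-trans 1≤q q≤n)) q 1≤q q≤n)
      υ₂-lower n true  q 1≤q q≤n = ≤-trans (x⊓y≤y (υ θ (fromℕ n)) (υ η (fromℕ n)))
        (proj₂ (υ-spec η n (ℕ.≤-trans 1≤q q≤n)) q 1≤q q≤n)

      υ₂-pos : Irrational θ → Irrational η → ∀ n → 1 ℕ.≤ n → 0# < υ₂ₙ n
      υ₂-pos θ-irr η-irr n 1≤n =
        let b , q , (1≤q , _) , eq = υ₂-attained n 1≤n
        in <-respʳ-≈ (sym eq) (*-pos (0<fromℕ 1≤q) (dist-pos (irr b) q 1≤q))
        where
        irr : ∀ b → Irrational (number b)
        irr false = θ-irr
        irr true  = η-irr

      υ₂-upper : (∀ n → 1 ℕ.≤ n → 0# < υ₂ₙ n) → ∀ {γ} (A : ℕ) {N : ℕ} →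
        limsup (λ t → t ^ᴿ (γ - 1#) * υ₂ θ η t) <± ⊤± → 1 ℕ.≤ N → fromℕ A ≤ fromℕ N * (γ - 1#) →
        ∃ λ C → 0# ≤ C × ∃ λ T → ∀ n → T ℕ.≤ n → υ₂ₙ n ^ N * fromℕ n ^ A ≤ C
      υ₂-upper υ₂-pos {γ} A {N} finite 1≤N A≤N[γ-1] =
        let T , 1≤T , b , bound = limsup<⊤⇒bounded (λ t → t ^ᴿ (γ - 1#) * υ₂ θ η t) finite
            T′ , T<T′ = archimedean T
        in ∣ b ∣ ^ N , ^-nonNeg N (0≤∣x∣ b) , T′ , λ n T′≤n →
          let T≤n = ≤-trans (<⇒≤ T<T′) (fromℕ-mono-≤ T′≤n)
          in upper b n (fromℕ-cancel-≤ {1} {n} (≤-respˡ-≈ (sym fromℕ-1) (≤-trans 1≤T T≤n))) (bound (fromℕ n) T≤n)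
        where
        upper : ∀ b n → 1 ℕ.≤ n → fromℕ n ^ᴿ (γ - 1#) * υ₂ₙ n ≤ b → υ₂ₙ n ^ N * fromℕ n ^ A ≤ ∣ b ∣ ^ N
        upper b n 1≤n bound =
          let s , 0≤s , s^N≈ , s≤ = root-≤-^ᴿ {fromℕ n} {γ - 1#} {A} {N} (1≤fromℕ 1≤n) 1≤N A≤N[γ-1]
              0≤υ = <⇒≤ (υ₂-pos n 1≤n)
          in begin
          υ₂ₙ n ^ N * fromℕ n ^ A    ≈⟨ trans (*-congˡ (sym s^N≈)) (*-comm _ _) ⟩
          s ^ N * υ₂ₙ n ^ N          ≈⟨ ^-distrib-* s (υ₂ₙ n) N ⟨
          (s * υ₂ₙ n) ^ N
            ≤⟨ ^-monoˡ-≤ N (*-nonNeg _ _ 0≤s 0≤υ) (≤-trans (*-monoʳ-≤ 0≤υ s≤) (≤-trans bound (x≤∣x∣ b))) ⟩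
          ∣ b ∣ ^ N                  ∎

      γ-set : ∀ {ϖ r} → ϖ-υ θ η ≈± [ ϖ ] → r < ϖ →
        ∃ λ γ → r < γ × limsup (λ t → t ^ᴿ (γ - 1#) * υ₂ θ η t) <± ⊤±
      γ-set {ϖ} {r} eq r<ϖ =
        let (γ , finite) , γ≰r = ¬∀⇒∃¬ {P = λ i → exponents i ≤ r} λ bounded →
              <⇒≱ r<ϖ ([≤]-injective (≤±-trans (TotalOrder.reflexive ℝ±-totalOrder ([≈]-sym eq))
                (proj₂ (⨆-spec exponents) [ r ] λ i → [ bounded i ]≤)))
        in γ , ≰⇒> γ≰r , finite
        where
        exponents : (∃ λ γ → limsup (λ t → t ^ᴿ (γ - 1#) * υ₂ θ η t) <± ⊤±) → ℝ
        exponents (γ , _) = γ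
        [≈]-sym : ∀ {x y} → x ≈± y → y ≈± x
        [≈]-sym = TotalOrder.Eq.sym ℝ±-totalOrder

      rational-exponents-incompatible : Irrational θ → Irrational η → ∀ {γ x w} {A B N : ℕ} →
        1 ℕ.≤ A → 1 ℕ.≤ N →
        limsup (λ t → t ^ᴿ (γ - 1#) * υ₂ θ η t) <± ⊤± → fromℕ A ≤ fromℕ N * (γ - 1#) →
        ω θ ≤± [ x ] → ω η ≤± [ x ] → x < w → 0# ≤ w → fromℕ N * w ≤ fromℕ (N ℕ.+ B) →
        ¬ (B ℕ.* B ℕ.* N ℕ.< A ℕ.* A ℕ.* (B ℕ.+ N))
      rational-exponents-incompatible θ-irr η-irr {A = A} {B} {N} 1≤A 1≤N finite A≤ ωθ≤x ωη≤x x<w 0≤w Nw≤ =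
        let pos = υ₂-pos θ-irr η-irr
            C , 0≤C , T₀ , upper = υ₂-upper pos A finite 1≤N A≤
            T₁ , lower₁ = ω<⇒quality-lower θ B ωθ≤x x<w 0≤w 1≤N Nw≤
            T₂ , lower₂ = ω<⇒quality-lower η B ωη≤x x<w 0≤w 1≤N Nw≤
            T = T₀ ℕ.⊔ (T₁ ℕ.⊔ T₂)
            T₁⊔T₂≤T = ℕ.m≤n⊔m T₀ (T₁ ℕ.⊔ T₂)
            lower : ∀ b q → T ℕ.≤ q → 1# ≤ quality (number b) q ^ N * fromℕ q ^ B
            lower = λ where
              false q T≤q → lower₁ q (ℕ.≤-trans (ℕ.≤-trans (ℕ.m≤m⊔n T₁ T₂) T₁⊔T₂≤T) T≤q)
              true  q T≤q → lower₂ q (ℕ.≤-trans (ℕ.≤-trans (ℕ.m≤n⊔m T₁ T₂) T₁⊔T₂≤T) T≤q)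
        in Records.exponents-incompatible number υ₂ₙ υ₂-attained υ₂-lower pos 1≤A 1≤N 0≤C T
             (λ n T≤n → upper n (ℕ.≤-trans (ℕ.m≤m⊔n T₀ (T₁ ℕ.⊔ T₂)) T≤n)) lower

  -- The polynomial G

  factors-nonNeg : ∀ {g h x} → h ≤ 1# → 1# < x → g ≤ x → 0# ≤ (x - g) * (x - h)
  factors-nonNeg h≤1 1<x g≤x = *-nonNeg _ _ (x≤y⇒0≤y-x g≤x) (x≤y⇒0≤y-x (≤-trans h≤1 (<⇒≤ 1<x)))

  -factors-pos : ∀ {g h x} → h ≤ 1# → 1# < x → x < g → 0# < - ((x - g) * (x - h))
  -factors-pos {g} {h} {x} h≤1 1<x x<g =
    <-respʳ-≈ (solve 3 (λ x g h → (g :- x) :* (x :- h) := :- ((x :- g) :* (x :- h))) refl x g h)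
      (*-pos (x<y⇒0<y-x x<g) (x<y⇒0<y-x (≤-<-trans h≤1 1<x)))

  module _ (ϖ : ℝ) where

    private
      S : ℝ
      S = ϖ ^ 2 - fromℕ 2 * ϖ + fromℕ 3

    abstract
      G-root : ∃ λ x → 1# ≤ x × G ϖ x ≈ 0# × (∀ y → G ϖ y ≈ 0# → y ≤ x)
      G-root =
        let 0≤disc : 0# ≤ S ^ 2 - fromℕ 4
            0≤disc = ≤-respʳ-≈
              (solve 1 (λ w → (w :- con (+ 1)) :* (w :- con (+ 1)) :*
                                ((w :- con (+ 1)) :* (w :- con (+ 1)) :+ con (+ 4))
                           := (w :^ 2 :- con (+ 2) :* w :+ con (+ 3)) :^ 2 :- con (+ 4)) refl ϖ)
              (*-nonNeg _ _ (0≤x² (ϖ - 1#)) (+-nonNeg (0≤x² (ϖ - 1#)) (0≤fromℕ 4)))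
            r , 0≤r , r²≈disc = root {2} (s≤s z≤n) 0≤disc
            x , 2x≈S+r        = divide (S + r) (0<fromℕ {2} (s≤s z≤n))
            1≤x : 1# ≤ x
            1≤x = *-cancelˡ-≤ (0<fromℕ {2} (s≤s z≤n)) (≤-respʳ-≈ (sym 2x≈S+r)
              (certify (+-nonNeg (0≤x² (ϖ - 1#)) 0≤r)
                (solve 2 (λ w r → (w :- con (+ 1)) :* (w :- con (+ 1)) :+ r
                               := (w :^ 2 :- con (+ 2) :* w :+ con (+ 3)) :+ r :- con (+ 2) :* con (+ 1)) refl ϖ r)))
            4G≈ : ∀ y → fromℕ 4 * G ϖ y ≈ (fromℕ 2 * y - S) ^ 2 - (S ^ 2 - fromℕ 4)
            4G≈ y = solve 2 (λ y s → con (+ 4) :* (y :^ 2 :- s :* y :+ con (+ 1))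
                               := (con (+ 2) :* y :- s) :^ 2 :- (s :^ 2 :- con (+ 4))) refl y S
            Gx≈0 : G ϖ x ≈ 0#
            Gx≈0 = x*y≈0⇒y≈0 (0<⇒≉0 (0<fromℕ {4} (s≤s z≤n))) (begin-equality
              fromℕ 4 * G ϖ x                              ≈⟨ 4G≈ x ⟩
              (fromℕ 2 * x - S) ^ 2 - (S ^ 2 - fromℕ 4)
                ≈⟨ +-cong (^-congˡ 2 (+-congʳ 2x≈S+r)) (-‿cong (sym r²≈disc)) ⟩
              (S + r - S) ^ 2 - r ^ 2
                ≈⟨ solve 2 (λ s r → (s :+ r :- s) :^ 2 :- r :^ 2 := con (+ 0)) refl S r ⟩
              0#                                           ∎)
            largest : ∀ y → G ϖ y ≈ 0# → y ≤ x
            largest y Gy≈0 = ≮⇒≥ λ x<y →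
              let r<2y-S : r < fromℕ 2 * y - S
                  r<2y-S = <-respˡ-≈ (trans (+-congʳ 2x≈S+r) (solve 2 (λ s r → s :+ r :- s := r) refl S r))
                             (+-monoˡ-< (- S) (*-monoˡ-< (0<fromℕ {2} (s≤s z≤n)) x<y))
              in <⇒≱ (^-monoˡ-< 1 0≤r r<2y-S) (≤-reflexive (begin-equality
                (fromℕ 2 * y - S) ^ 2
                  ≈⟨ x-y≈0⇒x≈y (trans (sym (4G≈ y)) (trans (*-congˡ Gy≈0) (zeroʳ _))) ⟩
                S ^ 2 - fromℕ 4           ≈⟨ r²≈disc ⟨
                r ^ 2                     ∎))
        in x , 1≤x , Gx≈0 , largest

      𝔤-spec : 1# ≤ 𝔤 ϖ × G ϖ (𝔤 ϖ) ≈ 0#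
      𝔤-spec =
        let x , 1≤x , Gx≈0 , largest = G-root
            ((y , Gy≈0) , 𝔤≈y) , upper = the-spec
              {P = λ x → (∃ λ i → x ≈ roots i) × Bounds.IsUpperBound _≤_ roots x}
              (x , ((x , Gx≈0) , refl) , λ (y , Gy≈0) → largest y Gy≈0)
        in ≤-trans 1≤x (upper (x , Gx≈0)) , trans (G-cong 𝔤≈y) Gy≈0
        where
        roots : (∃ λ x → G ϖ x ≈ 0#) → ℝ
        roots (x , _) = x
        G-cong : ∀ {x y} → x ≈ y → G ϖ x ≈ G ϖ y
        G-cong x≈y = +-congʳ (+-cong (^-congˡ 2 x≈y) (-‿cong (*-congˡ x≈y)))

      -- The product of the two roots of G is 1.
      G-factors : ∃ λ h → h ≤ 1# × (∀ x → G ϖ x ≈ (x - 𝔤 ϖ) * (x - h))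
      G-factors =
        let g = 𝔤 ϖ
            1≤g , Gg≈0 = 𝔤-spec
            h , gh≈1   = divide 1# (1≤⇒0< 1≤g)
            h≤1 : h ≤ 1#
            h≤1 = *-cancelˡ-≤ (1≤⇒0< 1≤g) (≤-cong (sym gh≈1) (sym (*-identityʳ g)) 1≤g)
            S≈g+h : S ≈ g + h
            S≈g+h = sym (x-y≈0⇒x≈y (begin-equality
              g + h - S
                ≈⟨ +-congʳ (+-cong (sym (trans (*-congˡ gh≈1) (*-identityʳ g))) (sym (*-identityʳ h))) ⟩
              g * (g * h) + h * 1# - S
                ≈⟨ +-congˡ (-‿cong (sym (trans (*-congˡ gh≈1) (*-identityʳ S)))) ⟩
              g * (g * h) + h * 1# - S * (g * h)
                ≈⟨ solve 3 (λ g h s → g :* (g :* h) :+ h :* con (+ 1) :- s :* (g :* h)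
                       := h :* (g :^ 2 :- s :* g :+ con (+ 1)))
                     refl g h S ⟩
              h * G ϖ g                            ≈⟨ *-congˡ Gg≈0 ⟩
              h * 0#                               ≈⟨ zeroʳ h ⟩
              0#                                   ∎))
        in h , h≤1 , λ x → begin-equality
        x ^ 2 - S * x + 1#                  ≈⟨ +-cong (+-congˡ (-‿cong (*-congʳ S≈g+h))) (sym gh≈1) ⟩
        x ^ 2 - (g + h) * x + g * h
          ≈⟨ solve 3 (λ x g h → x :^ 2 :- (g :+ h) :* x :+ g :* h := (x :- g) :* (x :- h)) refl x g h ⟩
        (x - g) * (x - h)                   ∎

      G≥0 : ∀ {x} → 1# < x → 𝔤 ϖ ≤ x → 0# ≤ G ϖ x
      G≥0 {x} 1<x 𝔤≤x =
        let h , h≤1 , factors = G-factors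
        in ≤-respʳ-≈ (sym (factors x)) (factors-nonNeg h≤1 1<x 𝔤≤x)

      0<-G : ∀ {x} → 1# < x → x < 𝔤 ϖ → 0# < - G ϖ x
      0<-G {x} 1<x x<𝔤 =
        let h , h≤1 , factors = G-factors
        in <-respʳ-≈ (-‿cong (sym (factors x))) (-factors-pos h≤1 1<x x<𝔤)

      ϖ<𝔤 : 1# < ϖ → ϖ < 𝔤 ϖ
      ϖ<𝔤 1<ϖ = ≰⇒> λ 𝔤≤ϖ → <⇒≱ (^-pos 3 (x<y⇒0<y-x 1<ϖ)) (certify (G≥0 1<ϖ 𝔤≤ϖ)
        (solve 1 (λ w → w :^ 2 :- (w :^ 2 :- con (+ 2) :* w :+ con (+ 3)) :* w :+ con (+ 1)
                     := con (+ 0) :- (w :- con (+ 1)) :^ 3) refl ϖ))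

      -- Here y = (u − 1)²/u, so that a = A/N satisfies (u − 1)² < a²u and a < ϖ − 1.
      rational-below-ϖ : 1# < ϖ → ∀ {u} → 1# < u → u < 𝔤 ϖ → ∃ λ y → ∃ λ A → ∃ λ N →
        1 ℕ.≤ A × 1 ℕ.≤ N × u * y ≈ (u - 1#) ^ 2 × fromℕ N ^ 2 * y < fromℕ A ^ 2 ×
        fromℕ A < fromℕ N * (ϖ - 1#)
      rational-below-ϖ 1<ϖ {u} 1<u u<𝔤 =
        let 0<u = <-trans 0<1 1<u
            y , uy≈ = divide ((u - 1#) ^ 2) 0<u
            0≤y : 0# ≤ y
            0≤y = *-cancelˡ-≤ 0<u (≤-cong (sym (zeroʳ u)) (sym uy≈) (^-nonNeg 2 (<⇒≤ (x<y⇒0<y-x 1<u))))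
            c , 0≤c , c²≈y = root {2} (s≤s z≤n) 0≤y
            y<[ϖ-1]² : y < (ϖ - 1#) ^ 2
            y<[ϖ-1]² = *-cancelˡ-< (<⇒≤ 0<u) (≰⇒> λ p → <⇒≱ (0<-G 1<u u<𝔤)
              (certify (x≤y⇒0≤y-x p) (trans (+-congʳ uy≈)
                (solve 2 (λ w u → (u :- con (+ 1)) :^ 2 :- u :* (w :- con (+ 1)) :^ 2
                  := con (+ 0) :- (:- (u :^ 2 :- (w :^ 2 :- con (+ 2) :* w :+ con (+ 3)) :* u :+ con (+ 1)))) refl ϖ u))))
            c<ϖ-1 : c < ϖ - 1#
            c<ϖ-1 = ≰⇒> λ ϖ-1≤c → <⇒≱ y<[ϖ-1]²
              (≤-respʳ-≈ c²≈y (^-monoˡ-≤ 2 (<⇒≤ (x<y⇒0<y-x 1<ϖ)) ϖ-1≤c))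
            A , N , 1≤N , Nc<A , A<N[ϖ-1] = rationals-dense 0≤c c<ϖ-1
            0≤Nc = *-nonNeg _ _ (0≤fromℕ N) 0≤c
        in y , A , N , fromℕ-cancel-< {0} {A} (≤-<-trans 0≤Nc Nc<A) , 1≤N , uy≈
         , <-respˡ-≈ (trans (^-distrib-* (fromℕ N) c 2) (*-congˡ c²≈y)) (^-monoˡ-< 1 0≤Nc Nc<A)
         , A<N[ϖ-1]

  abstract
    -- This is b² < a²(b + 1) for b = B/M = u − 1 and a = A/N.
    common-denominator : ∀ {u y} A B M N → 0# < u → 1 ℕ.≤ M → 1 ℕ.≤ N →
      fromℕ M * u ≈ fromℕ (M ℕ.+ B) → u * y ≈ (u - 1#) ^ 2 → fromℕ N ^ 2 * y < fromℕ A ^ 2 →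
      B ℕ.* N ℕ.* (B ℕ.* N) ℕ.* (M ℕ.* N) ℕ.< A ℕ.* M ℕ.* (A ℕ.* M) ℕ.* (B ℕ.* N ℕ.+ M ℕ.* N)
    common-denominator {u} {y} A B M N 0<u 1≤M 1≤N Mu≈M+B uy≈ N²y<A² =
      fromℕ-cancel-< {B ℕ.* N ℕ.* (B ℕ.* N) ℕ.* (M ℕ.* N)} {A ℕ.* M ℕ.* (A ℕ.* M) ℕ.* (B ℕ.* N ℕ.+ M ℕ.* N)} (begin-strict
      fromℕ (B ℕ.* N ℕ.* (B ℕ.* N) ℕ.* (M ℕ.* N))
        ≈⟨ trans (fromℕ-homo-* (B ℕ.* N ℕ.* (B ℕ.* N)) (M ℕ.* N)) (*-cong
             (trans (fromℕ-homo-* (B ℕ.* N) (B ℕ.* N)) (*-cong (fromℕ-homo-* B N) (fromℕ-homo-* B N)))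
             (fromℕ-homo-* M N)) ⟩
      b * n * (b * n) * p
        ≈⟨ *-congʳ (*-cong bn≈pv bn≈pv) ⟩
      p * v * (p * v) * p
        ≈⟨ solve 2 (λ p v → p :* v :* (p :* v) :* p := p :* p :* p :* v :^ 2) refl p v ⟩
      p * p * p * v ^ 2
        ≈⟨ *-cong (*-congʳ (solve 2 (λ m n → m :* n :* (m :* n) := m :* m :* n :^ 2) refl m n)) (sym uy≈) ⟩
      m * m * n ^ 2 * p * (u * y)
        ≈⟨ solve 5 (λ k l p u y → k :* l :* p :* (u :* y) := k :* p :* u :* (l :* y))
             refl (m * m) (n ^ 2) p u y ⟩
      m * m * p * u * (n ^ 2 * y)
        <⟨ *-monoˡ-< (*-pos (*-pos (*-pos 0<m 0<m) (*-pos 0<m (0<fromℕ 1≤N))) 0<u) N²y<A² ⟩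
      m * m * p * u * a ^ 2
        ≈⟨ solve 4 (λ k p u l → k :* p :* u :* l := l :* k :* (p :* u)) refl (m * m) p u (a ^ 2) ⟩
      a ^ 2 * (m * m) * (p * u)
        ≈⟨ *-cong (solve 2 (λ a m → a :^ 2 :* (m :* m) := a :* m :* (a :* m)) refl a m)
             (solve 3 (λ m n u → m :* n :* u := m :* u :* n) refl m n u) ⟩
      a * m * (a * m) * (m * u * n)
        ≈⟨ *-congˡ (trans (*-congʳ (trans Mu≈m+b (+-comm m b))) (distribʳ n b m)) ⟩
      a * m * (a * m) * (b * n + m * n)
        ≈⟨ trans (fromℕ-homo-* (A ℕ.* M ℕ.* (A ℕ.* M)) (B ℕ.* N ℕ.+ M ℕ.* N)) (*-cong
             (trans (fromℕ-homo-* (A ℕ.* M) (A ℕ.* M)) (*-cong (fromℕ-homo-* A M) (fromℕ-homo-* A M)))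
             (trans (fromℕ-homo-+ (B ℕ.* N) (M ℕ.* N)) (+-cong (fromℕ-homo-* B N) (fromℕ-homo-* M N)))) ⟨
      fromℕ (A ℕ.* M ℕ.* (A ℕ.* M) ℕ.* (B ℕ.* N ℕ.+ M ℕ.* N))   ∎)
      where
      a b m n p v : ℝ
      a = fromℕ A
      b = fromℕ B
      m = fromℕ M
      n = fromℕ N
      p = m * n
      v = u - 1#
      0<m : 0# < m
      0<m = 0<fromℕ 1≤M
      Mu≈m+b : m * u ≈ m + b
      Mu≈m+b = trans Mu≈M+B (fromℕ-homo-+ M B)
      bn≈pv : b * n ≈ p * v
      bn≈pv = begin-equality
        b * n               ≈⟨ *-congʳ (solve 2 (λ m b → b := m :+ b :- m) refl m b) ⟩
        (m + b - m) * n     ≈⟨ *-congʳ (+-congʳ Mu≈m+b) ⟨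
        (m * u - m) * n
          ≈⟨ solve 3 (λ m n u → (m :* u :- m) :* n := m :* n :* (u :- con (+ 1))) refl m n u ⟩
        p * v               ∎

    scaled-exponents-incompatible : ∀ {θ η} → Irrational θ → Irrational η → ∀ {γ z x w u y} {A B M N : ℕ} →
      limsup (λ t → t ^ᴿ (γ - 1#) * υ₂ θ η t) <± ⊤± → z + 1# < γ → fromℕ N * z ≈ fromℕ A →
      ω θ ≤± [ x ] → ω η ≤± [ x ] → x < w → 1# < w → fromℕ M * w < fromℕ (M ℕ.+ B) →
      1 ℕ.≤ A → 1 ℕ.≤ M → 1 ℕ.≤ N → 0# < u →
      fromℕ M * u ≈ fromℕ (M ℕ.+ B) → u * y ≈ (u - 1#) ^ 2 → fromℕ N ^ 2 * y < fromℕ A ^ 2 → ⊥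
    scaled-exponents-incompatible {θ} {η} θ-irr η-irr {γ} {z} {x} {w} {u} {y} {A} {B} {M} {N}
      finite 1+z<γ Nz≈A ωθ≤x ωη≤x x<w 1<w Mw< 1≤A 1≤M 1≤N 0<u Mu≈ uy≈ N²y<A² =
      rational-exponents-incompatible θ η θ-irr η-irr {γ} {x} {w} {A ℕ.* M} {B ℕ.* N} {M ℕ.* N}
        (ℕ.*-mono-≤ 1≤A 1≤M) (ℕ.*-mono-≤ 1≤M 1≤N) finite AM≤ ωθ≤x ωη≤x x<w (1≤⇒0≤ (<⇒≤ 1<w)) MNw≤
        (common-denominator A B M N 0<u 1≤M 1≤N Mu≈ uy≈ N²y<A²)
      where
      z≤γ-1 : z ≤ γ - 1#
      z≤γ-1 = certify (x≤y⇒0≤y-x (<⇒≤ 1+z<γ))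
        (solve 2 (λ z γ → γ :- (z :+ con (+ 1)) := γ :- con (+ 1) :- z) refl z γ)
      AM≤ : fromℕ (A ℕ.* M) ≤ fromℕ (M ℕ.* N) * (γ - 1#)
      AM≤ = begin
        fromℕ (A ℕ.* M)                        ≈⟨ trans (fromℕ-homo-* A M) (*-comm _ _) ⟩
        fromℕ M * fromℕ A                      ≈⟨ *-congˡ Nz≈A ⟨
        fromℕ M * (fromℕ N * z)                ≤⟨ *-monoˡ-≤ (0≤fromℕ M) (*-monoˡ-≤ (0≤fromℕ N) z≤γ-1) ⟩
        fromℕ M * (fromℕ N * (γ - 1#))         ≈⟨ *-assoc _ _ _ ⟨
        fromℕ M * fromℕ N * (γ - 1#)           ≈⟨ *-congʳ (fromℕ-homo-* M N) ⟨
        fromℕ (M ℕ.* N) * (γ - 1#)             ∎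
      MNw≤ : fromℕ (M ℕ.* N) * w ≤ fromℕ (M ℕ.* N ℕ.+ B ℕ.* N)
      MNw≤ = begin
        fromℕ (M ℕ.* N) * w                    ≈⟨ *-congʳ (fromℕ-homo-* M N) ⟩
        fromℕ M * fromℕ N * w
          ≈⟨ solve 3 (λ m n w → m :* n :* w := m :* w :* n) refl (fromℕ M) (fromℕ N) w ⟩
        fromℕ M * w * fromℕ N                  ≤⟨ *-monoʳ-≤ (0≤fromℕ N) (<⇒≤ Mw<) ⟩
        fromℕ (M ℕ.+ B) * fromℕ N              ≈⟨ fromℕ-homo-* (M ℕ.+ B) N ⟨
        fromℕ ((M ℕ.+ B) ℕ.* N)                ≡⟨ ≡.cong fromℕ (ℕ.*-distribʳ-+ N M B) ⟩
        fromℕ (M ℕ.* N ℕ.+ B ℕ.* N)            ∎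

    γ-above-rational : ∀ {θ η ϖ A N} → ϖ-υ θ η ≈± [ ϖ ] → 1 ℕ.≤ N → fromℕ A < fromℕ N * (ϖ - 1#) →
      ∃ λ γ → ∃ λ z → fromℕ N * z ≈ fromℕ A × z + 1# < γ ×
        limsup (λ t → t ^ᴿ (γ - 1#) * υ₂ θ η t) <± ⊤±
    γ-above-rational {θ} {η} {ϖ} {A} {N} ϖ-eq 1≤N A<N[ϖ-1] =
      let z , Nz≈A = divide (fromℕ A) (0<fromℕ 1≤N)
          z<ϖ-1 : z < ϖ - 1#
          z<ϖ-1 = *-cancelˡ-< (0≤fromℕ N) (<-respˡ-≈ (sym Nz≈A) A<N[ϖ-1])
          γ , 1+z<γ , finite = γ-set θ η ϖ-eq
            (<-respʳ-≈ (solve 1 (λ w → w :- con (+ 1) :+ con (+ 1) := w) refl ϖ) (+-monoˡ-< 1# z<ϖ-1))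
      in γ , z , Nz≈A , 1+z<γ , finite

    rational-above : ∀ {w g} → 1# < w → w < g → ∃ λ u → ∃ λ M → ∃ λ B → 1 ℕ.≤ M × w < u × u < g ×
      fromℕ M * u ≈ fromℕ (M ℕ.+ B) × fromℕ M * w < fromℕ (M ℕ.+ B)
    rational-above {w} {g} 1<w w<g =
      let W , M , 1≤M , Mw<W , W<Mg = rationals-dense (1≤⇒0≤ (<⇒≤ 1<w)) w<g
          M≤W = fromℕ-cancel-≤ {M} {W} (≤-trans (x≤x*y (0≤fromℕ M) (<⇒≤ 1<w)) (<⇒≤ Mw<W))
          B , M+B≡W = ℕ.m≤n⇒∃[o]m+o≡n M≤W
          W≈M+B : fromℕ W ≈ fromℕ (M ℕ.+ B)
          W≈M+B = reflexive (≡.cong fromℕ (≡.sym M+B≡W))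
          u , Mu≈W = divide (fromℕ W) (0<fromℕ 1≤M)
      in u , M , B , 1≤M
       , *-cancelˡ-< (0≤fromℕ M) (<-respʳ-≈ (sym Mu≈W) Mw<W)
       , *-cancelˡ-< (0≤fromℕ M) (<-respˡ-≈ (sym Mu≈W) W<Mg)
       , trans Mu≈W W≈M+B , <-respʳ-≈ W≈M+B Mw<W

    max-ω≮𝔤 : ∀ {θ η} → Irrational θ → Irrational η → ∀ {ϖ} → ϖ-υ θ η ≈± [ ϖ ] → 1# < ϖ →
      ∀ {x} → 1# ≤ x → x < 𝔤 ϖ → ω θ ≤± [ x ] → ω η ≤± [ x ] → ⊥
    max-ω≮𝔤 θ-irr η-irr {ϖ} ϖ-eq 1<ϖ 1≤x x<𝔤 ωθ≤x ωη≤x =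
      let w , x<w , w<𝔤 = between x<𝔤
          1<w = ≤-<-trans 1≤x x<w
          u , M , B , 1≤M , w<u , u<𝔤 , Mu≈ , Mw< = rational-above 1<w w<𝔤
          1<u = <-trans 1<w w<u
          y , A , N , 1≤A , 1≤N , uy≈ , N²y<A² , A<N[ϖ-1] = rational-below-ϖ ϖ 1<ϖ 1<u u<𝔤
          γ , z , Nz≈A , 1+z<γ , finite = γ-above-rational {A = A} {N} ϖ-eq 1≤N A<N[ϖ-1]
      in scaled-exponents-incompatible θ-irr η-irr {A = A} {B} {M} {N} finite 1+z<γ Nz≈A ωθ≤x ωη≤x x<w 1<w Mw<
           1≤A 1≤M 1≤N (<-trans 0<1 1<u) Mu≈ uy≈ N²y<A²

    ≱⇒bounded : ∀ {a b X} → a < b → ¬ ([ b ] ≤± X) → ∃ λ x → a ≤ x × x < b × X ≤± [ x ]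
    ≱⇒bounded {a} {X = ⊥±}    a<b _   = a , ≤-refl , a<b , ⊥±≤[ a ]
    ≱⇒bounded {a} {X = [ y ]} a<b b≰X = case total a y of λ where
      (inj₁ a≤y) → y , a≤y , ≰⇒> (λ b≤y → b≰X [ b≤y ]≤) , [ ≤-refl ]≤
      (inj₂ y≤a) → a , ≤-refl , a<b , [ y≤a ]≤
    ≱⇒bounded {b = b} {X = ⊤±} a<b b≰X = ⊥-elim (b≰X [ b ]≤⊤±)

    ⊔±≤⇒ : ∀ {X Y Z} → (X ⊔± Y) ≤± Z → X ≤± Z × Y ≤± Z
    ⊔±≤⇒ {X} {Y} p = ≤±-trans (Max±.x≤x⊔y X Y) p , ≤±-trans (Max±.x≤y⊔x X Y) p

    𝔤≤max-ω : ∀ {θ η} → Irrational θ → Irrational η → ∀ {ϖ} → ϖ-υ θ η ≈± [ ϖ ] → 1# < ϖ →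
      [ 𝔤 ϖ ] ≤± (ω θ ⊔± ω η)
    𝔤≤max-ω {θ} {η} θ-irr η-irr {ϖ} ϖ-eq 1<ϖ = decidable-stable lem λ 𝔤≰max →
      let x , 1≤x , x<𝔤 , max≤x = ≱⇒bounded {1#} {𝔤 ϖ} {ω θ ⊔± ω η} (<-trans 1<ϖ (ϖ<𝔤 ϖ 1<ϖ)) 𝔤≰max
          ωθ≤x , ωη≤x = ⊔±≤⇒ {ω θ} {ω η} max≤x
      in max-ω≮𝔤 θ-irr η-irr {ϖ} ϖ-eq 1<ϖ 1≤x x<𝔤 ωθ≤x ωη≤x

theorem3 : (lem : ExcludedMiddle 0ℓ) (R : CompleteOrderedField) →
    let open Exponents lem R in
    (θ η : ℝ) → Irrational θ → Irrational η →
    (ϖ : ℝ) → ϖ-υ θ η ≈± [ ϖ ] → 1# < ϖ →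
    ([ 𝔤 ϖ ] ≤± (ω θ ⊔± ω η)) × (ϖ < 𝔤 ϖ)
theorem3 lem R θ η θ-irr η-irr ϖ ϖ-eq 1<ϖ =
  Proof.𝔤≤max-ω lem R θ-irr η-irr ϖ-eq 1<ϖ , Proof.ϖ<𝔤 lem R ϖ 1<ϖ
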